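{- For every integer $n\ge 2$ with $n\neq 3$, the achromatic number of the Kneser graph $K(n,2)$ satisfies $\alpha(K(n,2))=\left\lfloor \binom{n+1}{2}/3\right\rfloor$, and $\alpha(K(3,2))=1$.
   Context: For integers $1\le k\le n/2$ (here $k=2$; the case $n=3$ is also allowed, where $K(3,2)$ is the edgeless graph on the three $2$-subsets of $[3]$), the Kneser graph $K(n,k)$ has as vertices all $k$-element subsets of $[n]=\{1,\dots,n\}$, two vertices being adjacent iff the subsets are disjoint. An $l$-coloring of a graph $G$ is a surjective map from $V(G)$ onto $[l]$; it is proper if adjacent vertices receive different colors, and complete if for every pair of distinct colors $i,j$ there is an edge $xy$ with $x$ colored $i$ and $y$ colored $j$. The achromatic number $\alpha(G)$ is the largest $l$ for which $G$ has a proper complete $l$-coloring. -}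

module Defs where

open import Data.Nat using (ℕ; _≤_)
open import Data.Fin using (Fin)
open import Data.Fin.Subset using (Subset; ∣_∣; _∩_; ⊥)
open import Data.Product using (Σ; ∃; _×_; _,_)
open import Relation.Binary.PropositionalEquality using (_≡_; _≢_)

record Graph : Set₁ where
  field
    V   : Set
    Adj : V → V → Set
open Graph public

Kneser : ℕ → ℕ → Graph
Kneser n k = record
  { V   = Σ (Subset n) (λ s → ∣ s ∣ ≡ k)
  ; Adj = λ { (s , _) (t , _) → s ∩ t ≡ ⊥ } }

Surjective : {A : Set} {l : ℕ} → (A → Fin l) → Set
Surjective {A} {l} c = ∀ (i : Fin l) → ∃ λ (x : A) → c x ≡ i

Proper : (G : Graph) {l : ℕ} → (V G → Fin l) → Set
Proper G c = ∀ x y → Adj G x y → c x ≢ c y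

Complete : (G : Graph) {l : ℕ} → (V G → Fin l) → Set
Complete G {l} c = ∀ (i j : Fin l) → i ≢ j →
  ∃ λ x → ∃ λ y → Adj G x y × c x ≡ i × c y ≡ j

IsProperCompleteColoring : (G : Graph) (l : ℕ) → (V G → Fin l) → Set
IsProperCompleteColoring G l c = Surjective c × Proper G c × Complete G c

AchromaticNumberIs : Graph → ℕ → Set
AchromaticNumberIs G m =
  (Σ (V G → Fin m) (IsProperCompleteColoring G m)) ×
  (∀ (l : ℕ) (c : V G → Fin l) → IsProperCompleteColoring G l c → l ≤ m)

{-# OPTIONS --safe #-}
-- Upper bound. Call the 1- and 2-subsets of [n] items; there are C(n+1,2) of them. Let a colour own its edges and
-- every point that lies on all of its edges. Completeness makes owners unique. The edges of a colour pairwise meet,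
-- so a colour with two edges owns their common point unless it has a third edge, and one with a single edge owns
-- its two ends: every colour owns three items.
--
-- Lower bound. The bound is attained, up to rounding, when the edges of the complete graph are partitioned into
-- triangles, paths of length two and single edges such that every point, with at most one exception, is the centre
-- of one path or the end of one single edge, but not both. Two blocks then contain disjoint edges, unless they are a path and the single edge
-- closing it to a triangle (this happens for n = 3). Such partitions come from the Bose–Skolem construction on
-- Q × ℤ/3 for a commutative quasigroup Q, possibly with one or two points added or one point deleted.
module Submission where

open import Defs
open import Data.Bool using (true; false)
import Data.Bool.Properties as Bool
open import Data.Empty using () renaming (⊥ to Absurd)
open import Data.Fin as Fin using (Fin; zero; suc; toℕ)
open import Data.Fin.Patterns using (0F; 1F; 2F)
import Data.Fin.Properties as Fin
open import Data.Fin.Subset using (Subset; inside; outside; ⊥; ⁅_⁆; _∈_; _∉_; _∪_; _∩_; ∣_∣)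
open import Data.Fin.Subset.Properties
  using ( x∈⁅x⁆; x∈⁅y⁆⇒x≡y; ∣⁅x⁆∣≡1; x∈p∪q⁺; x∈p∪q⁻; x∈p∩q⁺; x∈p∩q⁻; ∪-comm; ∪-assoc; ∪-identityˡ; ∪-identityʳ
        ; ∩-comm; ∉⊥; Empty-unique; nonempty?; anySubset? )
open import Data.List as List using (List; []; _∷_; _++_; length)
import Data.List.Properties as List
open import Data.List.Membership.Propositional using (lose) renaming (_∈_ to _∈ₗ_)
open import Data.List.Membership.Propositional.Properties
  using (∈-map⁺; ∈-map⁻; ∈-++⁺ˡ; ∈-++⁺ʳ; ∈-++⁻; ∈-deduplicate⁺; ∈-deduplicate⁻; ∈-lookup)
open import Data.List.Relation.Unary.All as All using ([]; _∷_)
open import Data.List.Relation.Unary.AllPairs using ([]; _∷_)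
open import Data.List.Relation.Unary.Any as Any using (here)
open import Data.List.Relation.Unary.Any.Properties using (lookup-index)
open import Data.List.Relation.Unary.Unique.DecPropositional.Properties using (deduplicate-!)
open import Data.List.Relation.Unary.Unique.Propositional using (Unique)
import Data.List.Relation.Unary.Unique.Propositional.Properties as Unique
open import Data.Nat as ℕ using (ℕ; zero; suc; _+_; _*_; _∸_; _≤_; _/_; _%_; s≤s; z≤n; NonZero)
import Data.Nat.Properties as ℕ
open import Data.Nat.Combinatorics using (_C_; nCk+nC[k+1]≡[n+1]C[k+1])
open import Data.Nat.DivMod
  using ( m*n/n≡m; /-monoˡ-≤; m<n*o⇒m/o<n; m%n%n≡m%n; %-distribˡ-+; %-distribˡ-*; [m+kn]%n≡m%n; m%n<n; m<n⇒m%n≡m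
        ; _mod_; _divMod_; result )
open import Data.Nat.Tactic.RingSolver using (solve-∀)
open import Data.Product using (Σ; ∃; ∃₂; _×_; _,_; proj₁; proj₂)
open import Data.Product.Algebra using (×-comm)
open import Data.Product.Function.NonDependent.Propositional using (_×-↔_)
open import Data.Product.Properties using (≡-dec)
open import Data.Sum using (_⊎_; inj₁; inj₂)
open import Data.Sum.Function.Propositional using (_⊎-↔_)
open import Data.Sum.Properties using (inj₂-injective)
open import Data.Vec using ([]; _∷_)
import Data.Vec.Properties as Vec
open import Function using (_∘_; case_of_; _↔_; Inverse; mk↔ₛ′)
open import Function.Construct.Composition using (_↔-∘_)
open import Function.Construct.Identity using (↔-id)
open import Function.Construct.Symmetry using (↔-sym)
open import Function.Definitions using (Injective)
open import Relation.Binary using (DecidableEquality)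
open import Relation.Binary.PropositionalEquality
open import Relation.Nullary using (¬_; Dec; yes; no; contradiction; ¬?)
open import Relation.Nullary.Decidable using (toWitnessFalse; _×-dec_; map′)

private
  variable
    n k : ℕ
    A P : Set

-- Singletons, pairs and triples as subsets.

infix 4 _≟ₛ_
_≟ₛ_ : DecidableEquality (Subset n)
_≟ₛ_ = Vec.≡-dec Bool._≟_

pair : Fin n → Fin n → Subset n
pair x y = ⁅ x ⁆ ∪ ⁅ y ⁆

triple : Fin n → Fin n → Fin n → Subset n
triple x y z = ⁅ x ⁆ ∪ pair y z

∈⁅⁆⇒≡ : {x y : Fin n} → x ∈ ⁅ y ⁆ → x ≡ y
∈⁅⁆⇒≡ {y = y} = x∈⁅y⁆⇒x≡y y

∈⁅⁆ : {x : Fin n} → x ∈ ⁅ x ⁆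
∈⁅⁆ {x = x} = x∈⁅x⁆ x

pairˡ : {x y : Fin n} → x ∈ pair x y
pairˡ = x∈p∪q⁺ (inj₁ ∈⁅⁆)

pairʳ : {x y : Fin n} → y ∈ pair x y
pairʳ = x∈p∪q⁺ (inj₂ ∈⁅⁆)

∈-pair : {u x y : Fin n} → u ∈ pair x y → u ≡ x ⊎ u ≡ y
∈-pair u∈ with x∈p∪q⁻ _ _ u∈
... | inj₁ p = inj₁ (∈⁅⁆⇒≡ p)
... | inj₂ p = inj₂ (∈⁅⁆⇒≡ p)

triple₁ : {x y z : Fin n} → x ∈ triple x y z
triple₁ = x∈p∪q⁺ (inj₁ ∈⁅⁆)

triple₂ : {x y z : Fin n} → y ∈ triple x y z
triple₂ = x∈p∪q⁺ (inj₂ pairˡ)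

triple₃ : {x y z : Fin n} → z ∈ triple x y z
triple₃ = x∈p∪q⁺ (inj₂ pairʳ)

∈-triple : {u x y z : Fin n} → u ∈ triple x y z → u ≡ x ⊎ u ≡ y ⊎ u ≡ z
∈-triple u∈ with x∈p∪q⁻ _ _ u∈
... | inj₁ p = inj₁ (∈⁅⁆⇒≡ p)
... | inj₂ p = inj₂ (∈-pair p)

pair-comm : (x y : Fin n) → pair x y ≡ pair y x
pair-comm x y = ∪-comm ⁅ x ⁆ ⁅ y ⁆

triple-swap : (x y z : Fin n) → triple y x z ≡ triple x y z
triple-swap x y z = begin
  ⁅ y ⁆ ∪ (⁅ x ⁆ ∪ ⁅ z ⁆) ≡⟨ ∪-assoc ⁅ y ⁆ ⁅ x ⁆ ⁅ z ⁆ ⟨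
  (⁅ y ⁆ ∪ ⁅ x ⁆) ∪ ⁅ z ⁆ ≡⟨ cong (_∪ ⁅ z ⁆) (∪-comm ⁅ y ⁆ ⁅ x ⁆) ⟩
  (⁅ x ⁆ ∪ ⁅ y ⁆) ∪ ⁅ z ⁆ ≡⟨ ∪-assoc ⁅ x ⁆ ⁅ y ⁆ ⁅ z ⁆ ⟩
  ⁅ x ⁆ ∪ (⁅ y ⁆ ∪ ⁅ z ⁆) ∎
  where open ≡-Reasoning

triple-rotate : (x y z : Fin n) → triple y z x ≡ triple x y z
triple-rotate x y z = begin
  ⁅ y ⁆ ∪ (⁅ z ⁆ ∪ ⁅ x ⁆) ≡⟨ cong (⁅ y ⁆ ∪_) (∪-comm ⁅ z ⁆ ⁅ x ⁆) ⟩
  triple y x z             ≡⟨ triple-swap x y z ⟩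
  triple x y z             ∎
  where open ≡-Reasoning

pair-injective : {x y u v : Fin n} → pair x y ≡ pair u v → (x ≡ u × y ≡ v) ⊎ (x ≡ v × y ≡ u)
pair-injective {x = x} {y} {u} {v} eq
  with ∈-pair (subst (x ∈_) eq pairˡ) | ∈-pair (subst (y ∈_) eq pairʳ)
     | ∈-pair (subst (u ∈_) (sym eq) pairˡ) | ∈-pair (subst (v ∈_) (sym eq) pairʳ)
... | inj₁ p | inj₂ q | _ | _ = inj₁ (p , q)
... | inj₂ p | inj₁ q | _ | _ = inj₂ (p , q)
... | inj₁ refl | inj₁ refl | _ | inj₁ r = inj₁ (refl , sym r)
... | inj₁ refl | inj₁ refl | _ | inj₂ r = inj₁ (refl , sym r)
... | inj₂ refl | inj₂ refl | inj₁ r | _ = inj₁ (sym r , refl)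
... | inj₂ refl | inj₂ refl | inj₂ r | _ = inj₁ (sym r , refl)

⁅⁆≢pair : {u x y : Fin n} → x ≢ y → ⁅ u ⁆ ≢ pair x y
⁅⁆≢pair x≢y eq = x≢y (trans (∈⁅⁆⇒≡ (subst (_ ∈_) (sym eq) pairˡ)) (sym (∈⁅⁆⇒≡ (subst (_ ∈_) (sym eq) pairʳ))))

⁅⁆-injective : {x y : Fin n} → ⁅ x ⁆ ≡ ⁅ y ⁆ → x ≡ y
⁅⁆-injective {x = x} eq = ∈⁅⁆⇒≡ (subst (x ∈_) eq ∈⁅⁆)

⁅⁆≢triple : {u x y z : Fin n} → x ≢ y → ⁅ u ⁆ ≢ triple x y z
⁅⁆≢triple x≢y eq = x≢y (trans (∈⁅⁆⇒≡ (subst (_ ∈_) (sym eq) triple₁)) (sym (∈⁅⁆⇒≡ (subst (_ ∈_) (sym eq) triple₂))))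

pair≢triple : {u v x y z : Fin n} → x ≢ y → y ≢ z → x ≢ z → pair u v ≢ triple x y z
pair≢triple {x = x} {y} {z} x≢y y≢z x≢z eq
  with ∈-pair (subst (x ∈_) (sym eq) triple₁) | ∈-pair (subst (y ∈_) (sym eq) triple₂) | ∈-pair (subst (z ∈_) (sym eq) triple₃)
... | inj₁ refl | inj₁ q | _ = x≢y (sym q)
... | inj₂ refl | inj₂ q | _ = x≢y (sym q)
... | inj₁ refl | _ | inj₁ q = x≢z (sym q)
... | inj₂ refl | _ | inj₂ q = x≢z (sym q)
... | _ | inj₁ refl | inj₁ q = y≢z (sym q)
... | _ | inj₂ refl | inj₂ q = y≢z (sym q)

∩≡⊥⇒disjoint : {s t : Subset n} {x : Fin n} → s ∩ t ≡ ⊥ → x ∈ s → x ∉ t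
∩≡⊥⇒disjoint {x = x} eq p q = ∉⊥ (subst (x ∈_) eq (x∈p∩q⁺ (p , q)))

pair-disjoint : {x y u v : Fin n} → x ≢ u → x ≢ v → y ≢ u → y ≢ v → pair x y ∩ pair u v ≡ ⊥
pair-disjoint {x = x} {y} {u} {v} xu xv yu yv = Empty-unique λ (w , w∈) → empty (x∈p∩q⁻ (pair x y) (pair u v) w∈)
  where
  empty : {w : Fin _} → ¬ (w ∈ pair x y × w ∈ pair u v)
  empty (p , q) with ∈-pair p | ∈-pair q
  ... | inj₁ refl | inj₁ e = xu e
  ... | inj₁ refl | inj₂ e = xv e
  ... | inj₂ refl | inj₁ e = yu e
  ... | inj₂ refl | inj₂ e = yv e

∣pair∣≡2 : {x y : Fin n} → x ≢ y → ∣ pair x y ∣ ≡ 2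
∣pair∣≡2 {x = zero}  {zero}  x≢y = contradiction refl x≢y
∣pair∣≡2 {x = zero}  {suc y} _   = cong suc (trans (cong ∣_∣ (∪-identityˡ ⁅ y ⁆)) (∣⁅x⁆∣≡1 y))
∣pair∣≡2 {x = suc x} {zero}  _   = cong suc (trans (cong ∣_∣ (∪-identityʳ ⁅ x ⁆)) (∣⁅x⁆∣≡1 x))
∣pair∣≡2 {x = suc x} {suc y} x≢y = ∣pair∣≡2 (x≢y ∘ cong suc)

-- Enumeration of the k-subsets and of the items.

Layer : ℕ → ℕ → Set
Layer n k = Σ (Subset n) λ s → ∣ s ∣ ≡ k

layer-≡ : {s t : Layer n k} → proj₁ s ≡ proj₁ t → s ≡ t
layer-≡ {s = s , _} {t = .s , _} refl = cong (s ,_) (ℕ.≡-irrelevant _ _)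

edge : {x y : Fin n} → x ≢ y → Layer n 2
edge {x = x} {y} x≢y = pair x y , ∣pair∣≡2 x≢y

size0 : (s : Subset n) → ∣ s ∣ ≡ 0 → s ≡ ⊥
size0 []          _  = refl
size0 (false ∷ s) eq = cong (outside ∷_) (size0 s eq)

size1 : (s : Subset n) → ∣ s ∣ ≡ 1 → ∃ λ x → s ≡ ⁅ x ⁆
size1 (false ∷ s) eq = let x , p = size1 s eq in suc x , cong (outside ∷_) p
size1 (true ∷ s)  eq = zero , cong (inside ∷_) (size0 s (ℕ.suc-injective eq))

size2 : (s : Subset n) → ∣ s ∣ ≡ 2 → ∃₂ λ x y → x ≢ y × s ≡ pair x y
size2 (false ∷ s) eq = let x , y , x≢y , p = size2 s eq in
  suc x , suc y , x≢y ∘ Fin.suc-injective , cong (outside ∷_) p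
size2 (true ∷ s)  eq = let y , p = size1 s (ℕ.suc-injective eq) in
  zero , suc y , (λ ()) , cong (inside ∷_) (trans p (sym (∪-identityˡ ⁅ y ⁆)))

add : Layer n k → Layer (suc n) (suc k)
add (s , p) = inside ∷ s , cong suc p

skip : Layer n k → Layer (suc n) k
skip (s , p) = outside ∷ s , p

layer : (n k : ℕ) → List (Layer n k)
layer zero    zero    = ([] , refl) ∷ []
layer zero    (suc k) = []
layer (suc n) zero    = List.map skip (layer n zero)
layer (suc n) (suc k) = List.map add (layer n k) ++ List.map skip (layer n (suc k))

∈-layer : (s : Layer n k) → s ∈ₗ layer n k
∈-layer {zero}  {zero}  ([] , refl)      = here refl
∈-layer {suc n} {zero}  (false ∷ s , p)  = ∈-map⁺ skip (∈-layer (s , p))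
∈-layer {suc n} {suc k} (false ∷ s , p)  = ∈-++⁺ʳ _ (∈-map⁺ skip (∈-layer (s , p)))
∈-layer {suc n} {suc k} (true ∷ s , p)   =
  ∈-++⁺ˡ (subst (_∈ₗ List.map add (layer n k)) (layer-≡ refl) (∈-map⁺ add (∈-layer (s , ℕ.suc-injective p))))

length-layer : (n k : ℕ) → length (layer n k) ≡ n C k
length-layer zero    zero    = refl
length-layer zero    (suc k) = refl
length-layer (suc n) zero    = trans (List.length-map skip (layer n zero)) (length-layer n zero)
length-layer (suc n) (suc k) = begin
  length (List.map add (layer n k) ++ List.map skip (layer n (suc k)))            ≡⟨ List.length-++ (List.map add (layer n k)) ⟩
  length (List.map add (layer n k)) + length (List.map skip (layer n (suc k)))    ≡⟨ cong₂ _+_ (List.length-map add (layer n k))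
                                                                                              (List.length-map skip (layer n (suc k))) ⟩
  length (layer n k) + length (layer n (suc k))                                   ≡⟨ cong₂ _+_ (length-layer n k) (length-layer n (suc k)) ⟩
  n C k + n C suc k                                                               ≡⟨ nCk+nC[k+1]≡[n+1]C[k+1] n k ⟩
  suc n C suc k                                                                   ∎
  where open ≡-Reasoning

layer-unique : (n k : ℕ) → Unique (layer n k)
layer-unique zero    zero    = [] ∷ []
layer-unique zero    (suc k) = []
layer-unique (suc n) zero    = Unique.map⁺ skip-injective (layer-unique n zero)
  where
  skip-injective : {s t : Layer n 0} → skip s ≡ skip t → s ≡ t
  skip-injective eq = layer-≡ (Vec.∷-injectiveʳ (cong proj₁ eq))
layer-unique (suc n) (suc k) = Unique.++⁺
  (Unique.map⁺ (λ eq → layer-≡ (Vec.∷-injectiveʳ (cong proj₁ eq))) (layer-unique n k))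
  (Unique.map⁺ (λ eq → layer-≡ (Vec.∷-injectiveʳ (cong proj₁ eq))) (layer-unique n (suc k)))
  λ { (p , q) → clash (∈-map⁻ add p) (∈-map⁻ skip q) }
  where
  clash : {u : Layer (suc n) (suc k)} → (∃ λ s → s ∈ₗ layer n k × u ≡ add s) → ¬ (∃ λ t → t ∈ₗ layer n (suc k) × u ≡ skip t)
  clash (_ , _ , refl) (_ , _ , ())

-- Points are listed as singletons, so that both kinds of item share the type `Subset n` and are
-- told apart by size. Pascal's rule then gives the length C(n+1,2).
items : (n : ℕ) → List (Subset n)
items n = List.map proj₁ (layer n 1) ++ List.map proj₁ (layer n 2)

length-items : (n : ℕ) → length (items n) ≡ suc n C 2
length-items n = begin
  length (items n)                            ≡⟨ List.length-++ (List.map proj₁ (layer n 1)) ⟩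
  _                                           ≡⟨ cong₂ _+_ (List.length-map proj₁ (layer n 1)) (List.length-map proj₁ (layer n 2)) ⟩
  length (layer n 1) + length (layer n 2)     ≡⟨ cong₂ _+_ (length-layer n 1) (length-layer n 2) ⟩
  n C 1 + n C 2                               ≡⟨ nCk+nC[k+1]≡[n+1]C[k+1] n 1 ⟩
  suc n C 2                                   ∎
  where open ≡-Reasoning

items-unique : (n : ℕ) → Unique (items n)
items-unique n = Unique.++⁺ (Unique.map⁺ layer-≡ (layer-unique n 1)) (Unique.map⁺ layer-≡ (layer-unique n 2))
  λ { (p , q) → clash (∈-map⁻ proj₁ p) (∈-map⁻ proj₁ q) }
  where
  clash : {u : Subset n} → (∃ λ s → s ∈ₗ layer n 1 × u ≡ proj₁ s) → ¬ (∃ λ t → t ∈ₗ layer n 2 × u ≡ proj₁ t)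
  clash ((_ , p) , _ , refl) ((_ , q) , _ , refl) with trans (sym p) q
  ... | ()

point∈items : (x : Fin n) → ⁅ x ⁆ ∈ₗ items n
point∈items x = ∈-++⁺ˡ (∈-map⁺ proj₁ (∈-layer (⁅ x ⁆ , ∣⁅x⁆∣≡1 x)))

edge∈items : (e : Layer n 2) → proj₁ e ∈ₗ items n
edge∈items {n} e = ∈-++⁺ʳ (List.map proj₁ (layer n 1)) (∈-map⁺ proj₁ (∈-layer e))

-- Finite quotients, search and three-element families.

index-injective : {xs : List A} {a b : A} {p : a ∈ₗ xs} {q : b ∈ₗ xs} → Any.index p ≡ Any.index q → a ≡ b
index-injective {xs = xs} {p = p} {q} eq = trans (lookup-index p) (trans (cong (List.lookup xs) eq) (sym (lookup-index q)))

lookup-injective : {xs : List A} → Unique xs → {i j : Fin (length xs)} → List.lookup xs i ≡ List.lookup xs j → i ≡ j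
lookup-injective (_ ∷ _)  {zero}  {zero}  _  = refl
lookup-injective (x∉ ∷ _) {zero}  {suc j} eq = contradiction eq (All.lookup x∉ (∈-lookup j))
lookup-injective (x∉ ∷ _) {suc i} {zero}  eq = contradiction (sym eq) (All.lookup x∉ (∈-lookup i))
lookup-injective (_ ∷ u)  {suc i} {suc j} eq = cong suc (lookup-injective u eq)

-- Turns a key on edges into a colouring, a colour being a class of edges with equal key. The number
-- of classes comes out as `size` and is identified only later; `rep` gives surjectivity and reduces
-- statements about colours to statements about edges.
record Quotient {A K : Set} (key : A → K) : Set where
  field
    size     : ℕ
    class    : A → Fin size
    rep      : Fin size → A
    class-rep : ∀ i → class (rep i) ≡ i
    sound    : ∀ {a b} → class a ≡ class b → key a ≡ key b
    complete : ∀ {a b} → key a ≡ key b → class a ≡ class b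

quotient : {A K : Set} (_≟_ : DecidableEquality K) (key : A → K) (as : List A) → (∀ a → a ∈ₗ as) → Quotient key
quotient {A} {K} _≟_ key as enum = record
  { size = length keys
  ; class = class
  ; rep = rep
  ; class-rep = λ i → lookup-injective keys! (trans (sym (lookup-index (key∈ (rep i)))) (sym (key-rep i)))
  ; sound = index-injective
  ; complete = λ {a} {b} eq → lookup-injective keys! (trans (sym (lookup-index (key∈ a))) (trans eq (lookup-index (key∈ b))))
  }
  where
  keys : List K
  -- A class is a position in this list. Its entries are distinct, so equal keys have equal
  -- positions; this gives `complete` and `class-rep`.
  keys = List.deduplicate _≟_ (List.map key as)
  keys! : Unique keys
  keys! = deduplicate-! _≟_ (List.map key as)
  key∈ : ∀ a → key a ∈ₗ keys
  key∈ a = ∈-deduplicate⁺ _≟_ (∈-map⁺ key (enum a))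
  class : A → Fin (length keys)
  class a = Any.index (key∈ a)
  preimage : ∀ i → ∃ λ a → a ∈ₗ as × List.lookup keys i ≡ key a
  preimage i = ∈-map⁻ key (∈-deduplicate⁻ _≟_ (List.map key as) (∈-lookup i))
  rep : Fin (length keys) → A
  rep i = proj₁ (preimage i)
  key-rep : ∀ i → List.lookup keys i ≡ key (rep i)
  key-rep i = proj₂ (proj₂ (preimage i))

search : {R : Layer n k → Set} → (∀ s → Dec (R s)) → Dec (∃ R)
search R? = map′ Any.satisfied (λ (s , r) → lose (∈-layer s) r) (Any.any? R? (layer _ _))

choose : A → A → A → Fin 3 → A
choose a b c 0F = a
choose a b c 1F = b
choose a b c 2F = c

choose-injective : {a b c : A} → a ≢ b → a ≢ c → b ≢ c → Injective _≡_ _≡_ (choose a b c)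
choose-injective ab ac bc {0F} {0F} _ = refl
choose-injective ab ac bc {0F} {1F} eq = contradiction eq ab
choose-injective ab ac bc {0F} {2F} eq = contradiction eq ac
choose-injective ab ac bc {1F} {0F} eq = contradiction (sym eq) ab
choose-injective ab ac bc {1F} {1F} _ = refl
choose-injective ab ac bc {1F} {2F} eq = contradiction eq bc
choose-injective ab ac bc {2F} {0F} eq = contradiction (sym eq) ac
choose-injective ab ac bc {2F} {1F} eq = contradiction (sym eq) bc
choose-injective ab ac bc {2F} {2F} _ = refl

choose-all : {P : A → Set} {a b c : A} → P a → P b → P c → ∀ k → P (choose a b c k)
choose-all pa pb pc 0F = pa
choose-all pa pb pc 1F = pb
choose-all pa pb pc 2F = pc

-- The upper bound: three owned items for every colour.

module UpperBound {n l : ℕ} (c : Layer n 2 → Fin l) (proper : Proper (Kneser n 2) c) (complete : Complete (Kneser n 2) c) where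

  edge≢point : ∀ {v} (e : Layer n 2) → proj₁ e ≢ ⁅ v ⁆
  edge≢point {v} (e , ∣e∣) eq with trans (sym ∣e∣) (trans (cong ∣_∣ eq) (∣⁅x⁆∣≡1 v))
  ... | ()

  data Owns (i : Fin l) : Subset n → Set where
    owned-edge  : ∀ e → c e ≡ i → Owns i (proj₁ e)
    owned-point : ∀ v → (∀ e → c e ≡ i → v ∈ proj₁ e) → Owns i ⁅ v ⁆

  -- An edge has only one colour, and a point owned by two colours would lie on both of the disjoint
  -- edges that completeness provides. The equation `p ≡ q` is a separate argument because matching
  -- cannot unify indices such as `proj₁ e` and `proj₁ f`.
  owner-unique : ∀ {i j p q} → p ≡ q → Owns i p → Owns j q → i ≡ j
  owner-unique eq (owned-edge e refl) (owned-edge f refl) = cong c (layer-≡ eq)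
  owner-unique eq (owned-edge e _) (owned-point v _) = contradiction eq (edge≢point e)
  owner-unique eq (owned-point v _) (owned-edge e _) = contradiction (sym eq) (edge≢point e)
  owner-unique {i} {j} eq (owned-point v f) (owned-point w g) with i Fin.≟ j | ⁅⁆-injective eq
  ... | yes i≡j | _    = i≡j
  ... | no  i≢j | refl =
    let x , y , adj , cx , cy = complete i j i≢j in contradiction (g y cy) (∩≡⊥⇒disjoint adj (f x cx))

  owned∈items : ∀ {i p} → Owns i p → p ∈ₗ items n
  owned∈items (owned-edge e _)  = edge∈items e
  owned∈items (owned-point v _) = point∈items v

  common : ∀ s t → c s ≡ c t → ∃ λ v → v ∈ proj₁ s × v ∈ proj₁ t
  common (s , p) (t , q) eq with nonempty? (s ∩ t)
  ... | yes (v , v∈) = v , x∈p∩q⁻ s t v∈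
  ... | no empty     = contradiction eq (proper _ _ (Empty-unique empty))

  Threefold : Fin l → Set
  Threefold i = ∃ λ (f : Fin 3 → Subset n) → Injective _≡_ _≡_ f × (∀ k → Owns i (f k))

  three : ∀ {i a b c} → a ≢ b → a ≢ c → b ≢ c → Owns i a → Owns i b → Owns i c → Threefold i
  three {i} {a} {b} {c} a≢b a≢c b≢c oa ob oc =
    choose a b c , choose-injective a≢b a≢c b≢c , choose-all {P = Owns i} {a} {b} {c} oa ob oc

  -- A colour class is not given as a list, so a second and then a third edge is found by decidable
  -- search. Stating the result for the colour of an edge `s` supplies the first edge; surjectivity
  -- extends it to all colours in `upper-bound`.
  threefold′ : ∀ s → Threefold (c s)
  threefold′ s with search (λ t → (c t Fin.≟ c s) ×-dec ¬? (proj₁ t ≟ₛ proj₁ s))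
  threefold′ s | no sole with size2 (proj₁ s) (proj₂ s)
  ... | x , y , x≢y , s≡ = three (edge≢point {x} s) (edge≢point {y} s) (x≢y ∘ ⁅⁆-injective)
      (owned-edge s refl) (owned-point x (λ e ce → subst (x ∈_) (sym (trans (only e ce) s≡)) pairˡ))
                                      (owned-point y (λ e ce → subst (y ∈_) (sym (trans (only e ce) s≡)) pairʳ))
    where
    only : ∀ e → c e ≡ c s → proj₁ e ≡ proj₁ s
    only e ce with proj₁ e ≟ₛ proj₁ s
    ... | yes e≡s = e≡s
    ... | no  e≢s = contradiction (e , ce , e≢s) sole
  threefold′ s | yes (t , ct , t≢s)
    with search (λ u → (c u Fin.≟ c s) ×-dec (¬? (proj₁ u ≟ₛ proj₁ s) ×-dec ¬? (proj₁ u ≟ₛ proj₁ t)))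
  ... | yes (u , cu , u≢s , u≢t) = three (t≢s ∘ sym) (u≢s ∘ sym) (u≢t ∘ sym)
      (owned-edge s refl) (owned-edge t ct) (owned-edge u cu)
  ... | no  neither with common s t (sym ct)
  ...   | v , v∈s , v∈t = three (t≢s ∘ sym) (edge≢point {v} s) (edge≢point {v} t)
      (owned-edge s refl) (owned-edge t ct) (owned-point v central)
    where
    central : ∀ e → c e ≡ c s → v ∈ proj₁ e
    central e ce with proj₁ e ≟ₛ proj₁ s | proj₁ e ≟ₛ proj₁ t
    ... | yes e≡s | _       = subst (v ∈_) (sym e≡s) v∈s
    ... | no _    | yes e≡t = subst (v ∈_) (sym e≡t) v∈t
    ... | no e≢s  | no e≢t  = contradiction (e , ce , e≢s , e≢t) neither

  -- Different colours own different items and each owns three, so `Fin (l * 3)`, read as pairs of a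
  -- colour and a slot, embeds into the list of items.
  upper-bound : Surjective c → l * 3 ≤ suc n C 2
  upper-bound surj = subst (l * 3 ≤_) (length-items n) (Fin.injective⇒≤ {f = position} position-injective)
    where
    threefold : ∀ i → Threefold i
    threefold i = let s , cs = surj i in subst Threefold cs (threefold′ s)
    item : Fin l × Fin 3 → Subset n
    item (i , k) = proj₁ (threefold i) k
    owned : ∀ x → Owns (proj₁ x) (item x)
    owned (i , k) = proj₂ (proj₂ (threefold i)) k
    item-injective : ∀ {x y} → item x ≡ item y → x ≡ y
    item-injective {x@(i , k)} {y@(j , m)} eq with owner-unique eq (owned x) (owned y)
    ... | refl = cong (i ,_) (proj₁ (proj₂ (threefold i)) eq)
    position : Fin (l * 3) → Fin (length (items n))
    position w = Any.index (owned∈items (owned (Fin.remQuot 3 w)))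
    position-injective : Injective _≡_ _≡_ position
    position-injective {v} {w} eq = begin
      v                                         ≡⟨ Fin.combine-remQuot {l} 3 v ⟨
      _                                         ≡⟨ cong (λ (i , k) → Fin.combine i k) (item-injective (index-injective eq)) ⟩
      _                                         ≡⟨ Fin.combine-remQuot {l} 3 w ⟩
      w                                         ∎
      where open ≡-Reasoning

-- Designs of triangles, paths and single edges.

data Cover {P : Set} (Tri Path : P → P → P → Set) (One : P → P → Set) (x y : P) : Set where
  tri  : ∀ {z} → Tri x y z → Cover Tri Path One x y
  -- An edge of a path joins its centre to an end, so either `x` is the centre (`out`) or `y` is
  -- (`into`).
  out  : ∀ {z} → Path x y z → Cover Tri Path One x y
  into : ∀ {z} → Path y x z → Cover Tri Path One x y
  one  : One x y → Cover Tri Path One x y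

data Claimed {P : Set} (Path : P → P → P → Set) (One : P → P → Set) (x : P) : Set where
  centre : ∀ {a b} → Path x a b → Claimed Path One x
  end    : ∀ {y} → One x y → Claimed Path One x

-- Triangles, paths with centre v and ends a, b, and single edges partition the edges of the complete graph on P;
-- `path-open` excludes the only way in which two blocks can fail to contain disjoint edges.
record Design (P : Set) : Set₁ where
  field
    Tri Path : P → P → P → Set
    One      : P → P → Set

    cover         : ∀ {x y} → x ≢ y → Cover Tri Path One x y
    tri-swap      : ∀ {x y z} → Tri x y z → Tri y x z
    tri-rotate    : ∀ {x y z} → Tri x y z → Tri y z x
    tri-≢         : ∀ {x y z} → Tri x y z → x ≢ y
    path-swap     : ∀ {v a b} → Path v a b → Path v b a
    path-≢        : ∀ {v a b} → Path v a b → v ≢ a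
    path-ends-≢   : ∀ {v a b} → Path v a b → a ≢ b
    one-sym       : ∀ {x y} → One x y → One y x
    one-≢         : ∀ {x y} → One x y → x ≢ y
    tri-unique    : ∀ {x y z w} → Tri x y z → Tri x y w → z ≡ w
    tri-path      : ∀ {x y z w} → Tri x y z → ¬ Path x y w
    tri-one       : ∀ {x y z} → Tri x y z → ¬ One x y
    path-path     : ∀ {v a b c} → Path v a b → ¬ Path a v c
    centre-unique : ∀ {v a b c d} → Path v a b → Path v c d → (a ≡ c × b ≡ d) ⊎ (a ≡ d × b ≡ c)
    path-one      : ∀ {v a b c} → Path v a b → ¬ One v c
    path-open     : ∀ {v a b} → Path v a b → ¬ One a b
    one-unique    : ∀ {x y z} → One x y → One x z → y ≡ z
    slack         : P
    claimed       : ∀ x → x ≡ slack ⊎ Claimed Path One x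

-- Colouring edges by their block, and the lower bound.

module Colouring {n : ℕ} (D : Design (Fin n)) where
  open Design D

  -- One edge can carry several shapes, since pairs and blocks can be written in different orders.
  -- The equation is kept as data because `s` need not be a `pair` definitionally.
  data Shape (s : Subset n) : Set where
    tri  : ∀ {x y z} → Tri x y z → s ≡ pair x y → Shape s
    path : ∀ {v a b} → Path v a b → s ≡ pair v a → Shape s
    one  : ∀ {x y} → One x y → s ≡ pair x y → Shape s

  shape : (e : Layer n 2) → Shape (proj₁ e)
  shape (s , ∣s∣) with size2 s ∣s∣
  ... | x , y , x≢y , eq with cover x≢y
  ...   | tri t  = tri t eq
  ...   | out p  = path p eq
  ...   | into p = path p (trans eq (pair-comm x y))
  ...   | one o    = one o eq

  -- The size of the key tells the three kinds of block apart.
  key : ∀ {s} → Shape s → Subset n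
  key (tri {x} {y} {z} _ _) = triple x y z
  key (path {v} _ _)        = ⁅ v ⁆
  key (one {x} {y} _ _)     = pair x y

  tri-≢₂ : ∀ {x y z} → Tri x y z → y ≢ z
  tri-≢₂ = tri-≢ ∘ tri-rotate

  tri-≢₃ : ∀ {x y z} → Tri x y z → x ≢ z
  tri-≢₃ t = tri-≢ (tri-rotate (tri-rotate t)) ∘ sym

  -- Disjointness of the blocks as sets of edges enters here. The mixed cases are excluded by
  -- `tri-path`, `tri-one` and `path-one`, and two paths with a common edge have the same centre by
  -- `path-path`. Hence the colour does not depend on the chosen shape.
  key-unique : ∀ {s t} (p : Shape s) (q : Shape t) → s ≡ t → key p ≡ key q
  key-unique (tri t e) (tri u f) eq with pair-injective (trans (sym e) (trans eq f))
  ... | inj₁ (refl , refl) rewrite tri-unique t u = refl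
  ... | inj₂ (refl , refl) rewrite tri-unique (tri-swap t) u = triple-swap _ _ _
  key-unique (tri t e) (path p f) eq with pair-injective (trans (sym e) (trans eq f))
  ... | inj₁ (refl , refl) = contradiction p (tri-path t)
  ... | inj₂ (refl , refl) = contradiction p (tri-path (tri-swap t))
  key-unique (tri t e) (one o f) eq with pair-injective (trans (sym e) (trans eq f))
  ... | inj₁ (refl , refl) = contradiction o (tri-one t)
  ... | inj₂ (refl , refl) = contradiction o (tri-one (tri-swap t))
  key-unique (path p e) (path q f) eq with pair-injective (trans (sym e) (trans eq f))
  ... | inj₁ (refl , refl) = refl
  ... | inj₂ (refl , refl) = contradiction q (path-path p)
  key-unique (path p e) (one o f) eq with pair-injective (trans (sym e) (trans eq f))
  ... | inj₁ (refl , refl) = contradiction o (path-one p)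
  ... | inj₂ (refl , refl) = contradiction (one-sym o) (path-one p)
  key-unique (one o e) (one q f) eq = trans (sym e) (trans eq f)
  key-unique p@(path _ _) q@(tri _ _) eq = sym (key-unique q p (sym eq))
  key-unique p@(one _ _) q@(tri _ _) eq = sym (key-unique q p (sym eq))
  key-unique p@(one _ _) q@(path _ _) eq = sym (key-unique q p (sym eq))

  Key : Layer n 2 → Subset n
  Key e = key (shape e)

  Key-tri : ∀ {x y z} (t : Tri x y z) (x≢y : x ≢ y) → Key (edge x≢y) ≡ triple x y z
  Key-tri t x≢y = key-unique (shape (edge x≢y)) (tri t refl) refl

  Key-path : ∀ {v a b} (p : Path v a b) → Key (edge (path-≢ p)) ≡ ⁅ v ⁆
  Key-path p = key-unique (shape (edge (path-≢ p))) (path p refl) refl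

  Key-one : ∀ {x y} (o : One x y) → Key (edge (one-≢ o)) ≡ pair x y
  Key-one o = key-unique (shape (edge (one-≢ o))) (one o refl) refl

  -- The completeness condition stated for keys, so that it can be proved kind by kind before
  -- colours are numbered.
  Meet : Subset n → Subset n → Set
  Meet k l = ∃₂ λ e f → Adj (Kneser n 2) e f × Key e ≡ k × Key f ≡ l

  meet-sym : ∀ {k l} → Meet k l → Meet l k
  meet-sym (e , f , adj , p , q) = f , e , trans (∩-comm (proj₁ f) (proj₁ e)) adj , q , p

  module _ {u v : Fin n} (u≢v : u ≢ v) where

    -- As `u v` is no side of the triangle, `v` is neither `y` nor `z`, so the side opposite `u`
    -- avoids it.
    apex-meet : ∀ {y z} → Tri u y z → Key (edge u≢v) ≢ triple u y z → Meet (triple u y z) (Key (edge u≢v))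
    apex-meet {y} {z} t k≢ = edge (tri-≢₂ t) , edge u≢v
      , pair-disjoint (tri-≢ t ∘ sym) y≢v (tri-≢₃ t ∘ sym) z≢v
      , trans (Key-tri (tri-rotate t) (tri-≢₂ t)) (triple-rotate u y z) , refl
      where
      y≢v : y ≢ v
      y≢v refl = k≢ (Key-tri t u≢v)
      z≢v : z ≢ v
      z≢v refl = k≢ (trans (Key-tri (tri-swap (tri-rotate (tri-rotate t))) u≢v)
                           (trans (triple-swap _ _ _) (sym (triple-rotate _ _ _))))

  -- An edge of another block contains at most one corner of the triangle. If it contains one, the
  -- opposite side avoids it; otherwise every side does.
  tri-meet : ∀ {x y z s} → Tri x y z → (q : Shape s) → ∣ s ∣ ≡ 2 → key q ≢ triple x y z → Meet (triple x y z) (key q)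
  tri-meet {x} {y} {z} {s} t q ∣s∣ k≢ with size2 s ∣s∣
  ... | u , v , u≢v , refl = subst (Meet _) (key-unique (shape (edge u≢v)) q refl)
                                   (go (k≢ ∘ trans (key-unique q (shape (edge u≢v)) refl)))
    where
    apexˡ : ∀ {x y z} → Tri x y z → u ≡ x → Key (edge u≢v) ≢ triple x y z → Meet (triple x y z) (Key (edge u≢v))
    apexˡ t refl = apex-meet u≢v t
    apexʳ : ∀ {x y z} → Tri x y z → v ≡ x → Key (edge u≢v) ≢ triple x y z → Meet (triple x y z) (Key (edge u≢v))
    apexʳ t refl k≢ = subst (Meet _) flip (apex-meet (u≢v ∘ sym) t (k≢ ∘ trans (sym flip)))
      where
      flip : Key (edge (u≢v ∘ sym)) ≡ Key (edge u≢v)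
      flip = key-unique (shape (edge (u≢v ∘ sym))) (shape (edge u≢v)) (pair-comm v u)
    rot : ∀ {k l} → k ≡ l → (Key (edge u≢v) ≢ k → Meet k (Key (edge u≢v))) → (Key (edge u≢v) ≢ l → Meet l (Key (edge u≢v)))
    rot refl f = f
    go : Key (edge u≢v) ≢ triple x y z → Meet (triple x y z) (Key (edge u≢v))
    go k≢ with u Fin.≟ x | u Fin.≟ y | u Fin.≟ z | v Fin.≟ x | v Fin.≟ y | v Fin.≟ z
    ... | yes e | _ | _ | _ | _ | _ = apexˡ t e k≢
    ... | _ | yes e | _ | _ | _ | _ = rot (triple-rotate x y z) (apexˡ (tri-rotate t) e) k≢
    ... | _ | _ | yes e | _ | _ | _ = rot (sym (triple-rotate z x y)) (apexˡ (tri-rotate (tri-rotate t)) e) k≢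
    ... | _ | _ | _ | yes e | _ | _ = apexʳ t e k≢
    ... | _ | _ | _ | _ | yes e | _ = rot (triple-rotate x y z) (apexʳ (tri-rotate t) e) k≢
    ... | _ | _ | _ | _ | _ | yes e = rot (sym (triple-rotate z x y)) (apexʳ (tri-rotate (tri-rotate t)) e) k≢
    ... | no ux | no uy | _ | no vx | no vy | _ = edge (tri-≢ t) , edge u≢v
      , pair-disjoint (ux ∘ sym) (vx ∘ sym) (uy ∘ sym) (vy ∘ sym) , Key-tri t (tri-≢ t) , refl

  path-meet : ∀ {v a b w c d} (p : Path v a b) (q : Path w c d) → pair v a ∩ pair w c ≡ ⊥ → Meet ⁅ v ⁆ ⁅ w ⁆
  path-meet p q adj = edge (path-≢ p) , edge (path-≢ q) , adj , Key-path p , Key-path q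

  -- The edge `v a` meets both edges of the second path, so `v b` is used. By `path-path` the point
  -- `v` is no end of the second path, hence `v b` avoids `a c` unless `b` is `c`, and then it
  -- avoids `a d`.
  chained-paths-meet : ∀ {v a b c d} → Path v a b → Path a c d → Meet ⁅ v ⁆ ⁅ a ⁆
  chained-paths-meet {v} {a} {b} {c} {d} p q with b Fin.≟ c
  ... | no b≢c = path-meet (path-swap p) q
        (pair-disjoint (path-≢ p) (λ { refl → path-path p q }) (path-ends-≢ p ∘ sym) b≢c)
  ... | yes refl = path-meet (path-swap p) (path-swap q)
        (pair-disjoint (path-≢ p) (λ { refl → path-path p (path-swap q) }) (path-ends-≢ p ∘ sym) (path-ends-≢ q))

  -- Apart from the chained cases, `v a` avoids `w c` or `w d`, because `a` equals at most one of
  -- the distinct ends `c` and `d`.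
  paths-meet : ∀ {v a b w c d} → Path v a b → Path w c d → v ≢ w → Meet ⁅ v ⁆ ⁅ w ⁆
  paths-meet {v} {a} {b} {w} {c} {d} p q v≢w with w Fin.≟ a | v Fin.≟ c | v Fin.≟ d | a Fin.≟ c
  ... | yes refl | _ | _ | _ = chained-paths-meet p q
  ... | _ | yes refl | _ | _ = meet-sym (chained-paths-meet q p)
  ... | _ | _ | yes refl | _ = meet-sym (chained-paths-meet (path-swap q) p)
  ... | no w≢a | no v≢c | no v≢d | no a≢c = path-meet p q (pair-disjoint v≢w v≢c (w≢a ∘ sym) a≢c)
  ... | no w≢a | no v≢c | no v≢d | yes refl =
        path-meet p (path-swap q) (pair-disjoint v≢w v≢d (w≢a ∘ sym) (path-ends-≢ q))

  -- The centre is off the single edge by `path-one`. If both `v a` and `v b` met `x y`, the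
  -- distinct points `a` and `b` would be its two ends, which `path-open` excludes.
  path-one-meet : ∀ {v a b x y} → Path v a b → One x y → Meet ⁅ v ⁆ (pair x y)
  path-one-meet {v} {a} {b} {x} {y} p o = go (a Fin.≟ x) (a Fin.≟ y) (b Fin.≟ x) (b Fin.≟ y)
    where
    v≢x : v ≢ x
    v≢x refl = path-one p o
    v≢y : v ≢ y
    v≢y refl = path-one p (one-sym o)
    via : ∀ {a b} → Path v a b → a ≢ x → a ≢ y → Meet ⁅ v ⁆ (pair x y)
    via p a≢x a≢y = edge (path-≢ p) , edge (one-≢ o) , pair-disjoint v≢x v≢y a≢x a≢y , Key-path p , Key-one o
    go : Dec (a ≡ x) → Dec (a ≡ y) → Dec (b ≡ x) → Dec (b ≡ y) → Meet ⁅ v ⁆ (pair x y)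
    go (no a≢x) (no a≢y) _ _ = via p a≢x a≢y
    go _ _ (no b≢x) (no b≢y) = via (path-swap p) b≢x b≢y
    go (yes refl) _ (yes refl) _ = contradiction refl (path-ends-≢ p)
    go (yes refl) _ _ (yes refl) = contradiction o (path-open p)
    go _ (yes refl) (yes refl) _ = contradiction (one-sym o) (path-open p)
    go _ (yes refl) _ (yes refl) = contradiction refl (path-ends-≢ p)

  -- Single edges form a matching by `one-unique`, so two different ones are disjoint.
  ones-meet : ∀ {x y u v} → One x y → One u v → pair x y ≢ pair u v → Meet (pair x y) (pair u v)
  ones-meet {x} {y} {u} {v} o q k≢ = edge (one-≢ o) , edge (one-≢ q)
    , pair-disjoint
        (λ { refl → k≢ (cong (pair x) (one-unique o q)) })
        (λ { refl → k≢ (trans (cong (pair x) (one-unique o (one-sym q))) (pair-comm x u)) })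
        (λ { refl → k≢ (trans (pair-comm x y) (cong (pair y) (one-unique (one-sym o) q))) })
        (λ { refl → k≢ (cong (λ w → pair w y) (one-unique (one-sym o) (one-sym q))) })
    , Key-one o , Key-one q

  meet : ∀ {s t} (p : Shape s) (q : Shape t) → ∣ s ∣ ≡ 2 → ∣ t ∣ ≡ 2 → key p ≢ key q → Meet (key p) (key q)
  meet (tri t _) q _ ∣t∣ k≢ = tri-meet t q ∣t∣ (k≢ ∘ sym)
  meet p@(path _ _) (tri t _) ∣s∣ _ k≢ = meet-sym (tri-meet t p ∣s∣ k≢)
  meet p@(one _ _)  (tri t _) ∣s∣ _ k≢ = meet-sym (tri-meet t p ∣s∣ k≢)
  meet (path p _) (path q _) _ _ k≢ = paths-meet p q (k≢ ∘ cong ⁅_⁆)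
  meet (path p _) (one o _) _ _ _ = path-one-meet p o
  meet (one o _) (path p _) _ _ _ = meet-sym (path-one-meet p o)
  meet (one o _) (one q _) _ _ k≢ = ones-meet o q k≢

  -- Equal keys leave three cases. For paths the centres are identified outright, whereas for
  -- triangles and single edges only an equation of sets remains, as the order of their points is
  -- not determined.
  data SameKey {s t} : Shape s → Shape t → Set where
    tri  : ∀ {x y z u v w} {T : Tri x y z} {U : Tri u v w} {e f} → triple x y z ≡ triple u v w → SameKey (tri T e) (tri U f)
    path : ∀ {v a b c d} {p : Path v a b} {q : Path v c d} {e f} → SameKey (path p e) (path q f)
    one  : ∀ {x y u v} {o : One x y} {q : One u v} {e f} → pair x y ≡ pair u v → SameKey (one o e) (one q f)

  same-key : ∀ {s t} (p : Shape s) (q : Shape t) → key p ≡ key q → SameKey p q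
  same-key (tri _ _) (tri _ _) eq = tri eq
  same-key (tri t _) (path _ _) eq = contradiction (sym eq) (⁅⁆≢triple (tri-≢ t))
  same-key (tri t _) (one _ _) eq = contradiction (sym eq) (pair≢triple (tri-≢ t) (tri-≢₂ t) (tri-≢₃ t))
  same-key (path _ _) (tri t _) eq = contradiction eq (⁅⁆≢triple (tri-≢ t))
  same-key (path _ _) (path _ _) eq with ⁅⁆-injective eq
  ... | refl = path
  same-key (path _ _) (one o _) eq = contradiction eq (⁅⁆≢pair (one-≢ o))
  same-key (one _ _) (tri t _) eq = contradiction eq (pair≢triple (tri-≢ t) (tri-≢₂ t) (tri-≢₃ t))
  same-key (one o _) (path _ _) eq = contradiction (sym eq) (⁅⁆≢pair (one-≢ o))
  same-key (one _ _) (one _ _) eq = one eq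

  -- This gives properness: the edges of a path share its centre, and two sides of a triangle have
  -- four ends among three points.
  intersecting : ∀ {s t} {p : Shape s} {q : Shape t} → SameKey p q → s ∩ t ≢ ⊥
  intersecting (path {e = refl} {refl}) adj = ∩≡⊥⇒disjoint adj pairˡ pairˡ
  intersecting (one {e = refl} {refl} eq) adj = ∩≡⊥⇒disjoint adj pairˡ (subst (_ ∈_) eq pairˡ)
  intersecting (tri {x} {y} {z} {u} {v} {U = U} {refl} {refl} eq) adj
    with ∈-triple (subst (u ∈_) (sym eq) triple₁) | ∈-triple (subst (v ∈_) (sym eq) triple₂)
  ... | inj₁ refl | _ = ∩≡⊥⇒disjoint adj pairˡ pairˡ
  ... | inj₂ (inj₁ refl) | _ = ∩≡⊥⇒disjoint adj pairʳ pairˡ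
  ... | _ | inj₁ refl = ∩≡⊥⇒disjoint adj pairˡ pairʳ
  ... | _ | inj₂ (inj₁ refl) = ∩≡⊥⇒disjoint adj pairʳ pairʳ
  ... | inj₂ (inj₂ refl) | inj₂ (inj₂ refl) = tri-≢ U refl

  -- These are three items that the colour of the block owns in the sense of the upper bound, which
  -- is why the two counts agree up to rounding.
  item : ∀ {s} → Shape s → Fin 3 → Subset n
  item (tri {x} {y} {z} _ _)  = choose (pair x y) (pair y z) (pair x z)
  item (path {v} {a} {b} _ _) = choose (pair v a) (pair v b) ⁅ v ⁆
  item (one {x} {y} _ _)      = choose (pair x y) ⁅ x ⁆ ⁅ y ⁆

  -- The shapes `p` and `q` may write one block in different orders, so the slot holding the edge
  -- depends on how their points correspond.
  edge-item : ∀ {s t} {p : Shape s} {q : Shape t} → SameKey p q → ∃ λ k → item q k ≡ s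
  edge-item (path {p = p} {q} {refl}) with centre-unique p q
  ... | inj₁ (refl , refl) = 0F , refl
  ... | inj₂ (refl , refl) = 1F , refl
  edge-item (one {e = refl} eq) = 0F , sym eq
  edge-item (tri {x} {y} {z} {T = T} {e = refl} eq)
    with ∈-triple (subst (x ∈_) eq triple₁) | ∈-triple (subst (y ∈_) eq triple₂)
  ... | inj₁ refl        | inj₁ refl        = contradiction refl (tri-≢ T)
  ... | inj₁ refl        | inj₂ (inj₁ refl) = 0F , refl
  ... | inj₁ refl        | inj₂ (inj₂ refl) = 2F , refl
  ... | inj₂ (inj₁ refl) | inj₁ refl        = 0F , pair-comm _ _
  ... | inj₂ (inj₁ refl) | inj₂ (inj₁ refl) = contradiction refl (tri-≢ T)
  ... | inj₂ (inj₁ refl) | inj₂ (inj₂ refl) = 1F , refl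
  ... | inj₂ (inj₂ refl) | inj₁ refl        = 2F , pair-comm _ _
  ... | inj₂ (inj₂ refl) | inj₂ (inj₁ refl) = 1F , pair-comm _ _
  ... | inj₂ (inj₂ refl) | inj₂ (inj₂ refl) = contradiction refl (tri-≢ T)

  centre-item : ∀ {v a b t} {p : Path v a b} {e : pair v a ≡ pair v a} {q : Shape t} →
                SameKey (path p e) q → ∃ λ k → item q k ≡ ⁅ v ⁆
  centre-item path = 2F , refl

  end-item : ∀ {x y t} {o : One x y} {e : pair x y ≡ pair x y} {q : Shape t} → SameKey (one o e) q → ∃ λ k → item q k ≡ ⁅ x ⁆
  end-item (one eq) with pair-injective eq
  ... | inj₁ (refl , refl) = 1F , refl
  ... | inj₂ (refl , refl) = 2F , refl

  open Quotient (quotient _≟ₛ_ Key (layer n 2) ∈-layer)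

  colouring : IsProperCompleteColoring (Kneser n 2) size class
  colouring = (λ i → rep i , class-rep i)
    , (λ e f adj eq → intersecting (same-key (shape e) (shape f) (sound eq)) adj)
    , λ i j i≢j →
        let e , f , adj , p , q = meet (shape (rep i)) (shape (rep j)) (proj₂ (rep i)) (proj₂ (rep j))
                                       (λ eq → i≢j (trans (sym (class-rep i)) (trans (complete eq) (class-rep j))))
        in e , f , adj , trans (complete p) (class-rep i) , trans (complete q) (class-rep j)

  -- Three slots for each colour, filled from the shape of its representative, and one extra slot
  -- for the point that may be left unclaimed.
  block-items : Fin (suc (size * 3)) → Subset n
  block-items zero    = ⁅ slack ⁆
  block-items (suc w) = let i , k = Fin.remQuot {size} 3 w in item (shape (rep i)) k

  Listed : Subset n → Set
  Listed p = ∃ λ w → block-items w ≡ p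

  -- Only the representative's way of writing the block is listed, so `f` has to find `p` among the
  -- items of any shape with the same key as `c`.
  listed : ∀ {p} (e : Layer n 2) (c : Shape (proj₁ e)) →
           (∀ {t} {q : Shape t} → SameKey c q → ∃ λ k → item q k ≡ p) → Listed p
  listed e c f =
    let i = class e
        k , eq = f (same-key c (shape (rep i)) (trans (key-unique c (shape e) refl) (sound (sym (class-rep i)))))
    in suc (Fin.combine i k) , trans (cong (λ (i , k) → item (shape (rep i)) k) (Fin.remQuot-combine i k)) eq

  point-listed : ∀ x → Listed ⁅ x ⁆
  point-listed x with claimed x
  ... | inj₁ refl         = zero , refl
  ... | inj₂ (centre p) = listed (edge (path-≢ p)) (path p refl) centre-item
  ... | inj₂ (end o)    = listed (edge (one-≢ o)) (one o refl) end-item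

  item-listed : ∀ {p} → p ∈ₗ items n → Listed p
  item-listed p∈ with ∈-++⁻ (List.map proj₁ (layer n 1)) p∈
  ... | inj₁ p∈₁ with ∈-map⁻ proj₁ p∈₁
  ...   | (s , ∣s∣) , _ , refl = let x , eq = size1 s ∣s∣ in subst Listed (sym eq) (point-listed x)
  item-listed p∈ | inj₂ p∈₂ with ∈-map⁻ proj₁ p∈₂
  ...   | e , _ , refl = listed e (shape e) edge-item

  -- Every item occurs in some slot and a slot holds one item, so a choice of slots is injective.
  lower-bound : suc n C 2 ≤ suc (size * 3)
  lower-bound = subst (_≤ suc (size * 3)) (length-items n) (Fin.injective⇒≤ {f = slot} slot-injective)
    where
    slot : Fin (length (items n)) → Fin (suc (size * 3))
    slot j = proj₁ (item-listed (∈-lookup j))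
    slot-injective : Injective _≡_ _≡_ slot
    slot-injective {i} {j} eq = lookup-injective (items-unique n)
      (trans (sym (proj₂ (item-listed (∈-lookup i)))) (trans (cong block-items eq) (proj₂ (item-listed (∈-lookup j)))))

-- The achromatic number from a design.

module _ {n : ℕ} where

  achromatic≤ : ∀ l (c : Layer n 2 → Fin l) → IsProperCompleteColoring (Kneser n 2) l c → l ≤ (suc n C 2) / 3
  achromatic≤ l c (surj , proper , complete) = subst (_≤ (suc n C 2) / 3) (m*n/n≡m l 3)
    (/-monoˡ-≤ 3 (UpperBound.upper-bound c proper complete surj))

  -- The number of blocks is not counted directly: the upper bound, applied to this very colouring,
  -- limits it from above, and `lower-bound` limits it from below.
  design⇒achromatic : Design (Fin n) → AchromaticNumberIs (Kneser n 2) ((suc n C 2) / 3)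
  design⇒achromatic D = subst (λ m → Σ (Layer n 2 → Fin m) (IsProperCompleteColoring (Kneser n 2) m)) size≡ (class , colouring)
    , achromatic≤
    where
    open Colouring D
    open Quotient (quotient _≟ₛ_ Key (layer n 2) ∈-layer)
    size≡ : size ≡ (suc n C 2) / 3
    size≡ = ℕ.≤-antisym (achromatic≤ size class colouring)
      -- From C(n+1,2) ≤ 3 size + 1 < 3 (size + 1) the quotient by 3 is at most `size`; the rounding
      -- thus absorbs one unclaimed point.
      (ℕ.s≤s⁻¹ (m<n*o⇒m/o<n {o = 3} (ℕ.≤-trans (s≤s lower-bound) (s≤s (s≤s (ℕ.n≤1+n _))))))

-- Designs are built on structured point sets such as `Q × Fin 3` and moved to `Fin n` only at the
-- end.
transport : A ↔ P → Design P → Design A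
transport {A} {P} A↔P D = record
  { Tri = λ x y z → Tri (to x) (to y) (to z)
  ; Path = λ x y z → Path (to x) (to y) (to z)
  ; One = λ x y → One (to x) (to y)
  ; cover = λ x≢y → cover′ (cover (x≢y ∘ to-injective))
  ; tri-swap = tri-swap
  ; tri-rotate = tri-rotate
  ; tri-≢ = λ t → tri-≢ t ∘ cong to
  ; path-swap = path-swap
  ; path-≢ = λ p → path-≢ p ∘ cong to
  ; path-ends-≢ = λ p → path-ends-≢ p ∘ cong to
  ; one-sym = one-sym
  ; one-≢ = λ o → one-≢ o ∘ cong to
  ; tri-unique = λ t u → to-injective (tri-unique t u)
  ; tri-path = tri-path
  ; tri-one = tri-one
  ; path-path = path-path
  ; centre-unique = λ p q → case centre-unique p q of λ
      { (inj₁ (e , f)) → inj₁ (to-injective e , to-injective f)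
      ; (inj₂ (e , f)) → inj₂ (to-injective e , to-injective f) }
  ; path-one = path-one
  ; path-open = path-open
  ; one-unique = λ o p → to-injective (one-unique o p)
  ; slack = from slack
  ; claimed = claimed′
  }
  where
  open Design D
  open Inverse A↔P using (to; from; strictlyInverseˡ; strictlyInverseʳ)
  to-injective : ∀ {x y} → to x ≡ to y → x ≡ y
  to-injective eq = trans (sym (strictlyInverseʳ _)) (trans (cong from eq) (strictlyInverseʳ _))
  cover′ : ∀ {x y} → Cover Tri Path One (to x) (to y) →
           Cover (λ x y z → Tri (to x) (to y) (to z)) (λ x y z → Path (to x) (to y) (to z)) (λ x y → One (to x) (to y)) x y
  cover′ (tri {z} t)  = tri {z = from z} (subst (Tri _ _) (sym (strictlyInverseˡ z)) t)
  cover′ (out {z} p)  = out {z = from z} (subst (Path _ _) (sym (strictlyInverseˡ z)) p)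
  cover′ (into {z} p) = into {z = from z} (subst (Path _ _) (sym (strictlyInverseˡ z)) p)
  cover′ (one o)      = one o
  claimed′ : ∀ x → x ≡ from slack ⊎ Claimed (λ x y z → Path (to x) (to y) (to z)) (λ x y → One (to x) (to y)) x
  claimed′ x with claimed (to x)
  ... | inj₁ eq = inj₁ (trans (sym (strictlyInverseʳ x)) (cong from eq))
  ... | inj₂ (centre {a} {b} p) = inj₂ (centre {a = from a} {from b}
        (subst₂ (Path _) (sym (strictlyInverseˡ a)) (sym (strictlyInverseˡ b)) p))
  ... | inj₂ (end {y} o) = inj₂ (end {y = from y} (subst (One _) (sym (strictlyInverseˡ y)) o))

-- The Bose construction: quasigroups, levels and triangles.

record CommutativeQuasigroup (Q : Set) : Set where
  infixl 7 _∙_ _\\_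
  field
    _∙_ _\\_    : Q → Q → Q
    comm        : ∀ x y → x ∙ y ≡ y ∙ x
    leftDividesˡ : ∀ x z → x ∙ (x \\ z) ≡ z
    leftDividesʳ : ∀ x y → x \\ (x ∙ y) ≡ y

  cancelˡ : ∀ x {y z} → x ∙ y ≡ x ∙ z → y ≡ z
  cancelˡ x eq = trans (sym (leftDividesʳ x _)) (trans (cong (x \\_) eq) (leftDividesʳ x _))

-- The successor relation of ℤ/3; as an indexed type it lets levels be compared by matching.
data Up : Fin 3 → Fin 3 → Set where
  up₀ : Up 0F 1F
  up₁ : Up 1F 2F
  up₂ : Up 2F 0F

Up-functional : ∀ {i j k} → Up i j → Up i k → j ≡ k
Up-functional up₀ up₀ = refl
Up-functional up₁ up₁ = refl
Up-functional up₂ up₂ = refl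

Up-injective : ∀ {i j k} → Up i k → Up j k → i ≡ j
Up-injective up₀ up₀ = refl
Up-injective up₁ up₁ = refl
Up-injective up₂ up₂ = refl

Up-irrefl : ∀ {i} → ¬ Up i i
Up-irrefl ()

Up-asym : ∀ {i j} → Up i j → ¬ Up j i
Up-asym up₀ ()
Up-asym up₁ ()
Up-asym up₂ ()

next : ∀ i → ∃ (Up i)
next 0F = 1F , up₀
next 1F = 2F , up₁
next 2F = 0F , up₂

previous : ∀ j → ∃ λ i → Up i j
previous 0F = 2F , up₂
previous 1F = 0F , up₀
previous 2F = 1F , up₁

data Compare (i j : Fin 3) : Set where
  same : i ≡ j → Compare i j
  up   : Up i j → Compare i j
  down : Up j i → Compare i j

compare : ∀ i j → Compare i j
compare 0F 0F = same refl
compare 0F 1F = up up₀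
compare 0F 2F = down up₂
compare 1F 0F = down up₀
compare 1F 1F = same refl
compare 1F 2F = up up₁
compare 2F 0F = up up₂
compare 2F 1F = down up₁
compare 2F 2F = same refl

-- The three levels in any order: the constructors are the two orientations, so the relation is
-- closed under all permutations.
data Cycle : Fin 3 → Fin 3 → Fin 3 → Set where
  fwd : ∀ {i j k} → Up i j → Up j k → Up k i → Cycle i j k
  bwd : ∀ {i j k} → Up j i → Up k j → Up i k → Cycle i j k

Cycle-swap : ∀ {i j k} → Cycle i j k → Cycle j i k
Cycle-swap (fwd p q r) = bwd p r q
Cycle-swap (bwd p q r) = fwd p r q

Cycle-rotate : ∀ {i j k} → Cycle i j k → Cycle j k i
Cycle-rotate (fwd p q r) = fwd q r p
Cycle-rotate (bwd p q r) = bwd q r p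

Cycle-≢ : ∀ {i j k} → Cycle i j k → i ≢ j
Cycle-≢ (fwd p _ _) refl = Up-irrefl p
Cycle-≢ (bwd p _ _) refl = Up-irrefl p

Cycle-unique : ∀ {i j k l} → Cycle i j k → Cycle i j l → k ≡ l
Cycle-unique (fwd _ q _) (fwd _ q′ _) = Up-functional q q′
Cycle-unique (fwd p _ _) (bwd p′ _ _) = contradiction p′ (Up-asym p)
Cycle-unique (bwd p _ _) (fwd p′ _ _) = contradiction p′ (Up-asym p)
Cycle-unique (bwd _ _ r) (bwd _ _ r′) = Up-functional r r′

Up⇒Cycle : ∀ {i j} → Up i j → ∃ (Cycle i j)
Up⇒Cycle up₀ = 2F , fwd up₀ up₁ up₂
Up⇒Cycle up₁ = 0F , fwd up₁ up₂ up₀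
Up⇒Cycle up₂ = 1F , fwd up₂ up₀ up₁

-- The triangles {(x , i) , (y , i) , (x ∙ y , i + 1)} with x ≢ y leave only the edges from (x , i) to (x ∙ x , i + 1).
module Bose {Q : Set} (_≟_ : DecidableEquality Q) (op : Fin 3 → CommutativeQuasigroup Q) where

  private module Op (i : Fin 3) = CommutativeQuasigroup (op i)

  infixl 7 _∙[_]_
  _∙[_]_ : Q → Fin 3 → Q → Q
  x ∙[ i ] y = Op._∙_ i x y

  Point : Set
  Point = Q × Fin 3

  -- The constructors put the point of the next level last, in the middle and first; commutativity
  -- supplies the remaining orders.
  data Core : Point → Point → Point → Set where
    base  : ∀ {x y z i j} → x ≢ y → z ≡ x ∙[ i ] y → Up i j → Core (x , i) (y , i) (z , j)
    left  : ∀ {x y z i j} → x ≢ y → z ≡ x ∙[ i ] y → Up i j → Core (x , i) (z , j) (y , i)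
    right : ∀ {x y z i j} → x ≢ y → z ≡ x ∙[ i ] y → Up i j → Core (z , j) (x , i) (y , i)

  data Diagonal : Point → Point → Set where
    diagonal : ∀ {x z i j} → z ≡ x ∙[ i ] x → Up i j → Diagonal (x , i) (z , j)

  core-swap : ∀ {p q r} → Core p q r → Core q p r
  core-swap (base {x} {y} {i = i} x≢y e u) = base (x≢y ∘ sym) (trans e (Op.comm i x y)) u
  core-swap (left x≢y e u)  = right x≢y e u
  core-swap (right x≢y e u) = left x≢y e u

  core-rotate : ∀ {p q r} → Core p q r → Core q r p
  core-rotate (base {x} {y} {i = i} x≢y e u) = left (x≢y ∘ sym) (trans e (Op.comm i x y)) u
  core-rotate (left {x} {y} {i = i} x≢y e u) = right (x≢y ∘ sym) (trans e (Op.comm i x y)) u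
  core-rotate (right x≢y e u) = base x≢y e u

  core-≢ : ∀ {p q r} → Core p q r → p ≢ q
  core-≢ (base x≢y _ _) refl = x≢y refl
  core-≢ (left _ _ u)   refl = Up-irrefl u
  core-≢ (right _ _ u)  refl = Up-irrefl u

  -- The levels of the first two points determine the constructor. On one level the third point is
  -- the product; on consecutive levels it is determined by cancellation.
  core-unique : ∀ {p q r s} → Core p q r → Core p q s → r ≡ s
  core-unique (base _ e u)  (base _ f v) = cong₂ _,_ (trans e (sym f)) (Up-functional u v)
  core-unique (base _ _ _)  (left _ _ v)  = contradiction v Up-irrefl
  core-unique (base _ _ _)  (right _ _ v) = contradiction v Up-irrefl
  core-unique (left _ _ u)  (base _ _ _) = contradiction u Up-irrefl
  core-unique (left {x} {i = i} _ e u) (left _ f v) = cong (_, i) (Op.cancelˡ i x (trans (sym e) f))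
  core-unique (left _ _ u)  (right _ _ v) = contradiction v (Up-asym u)
  core-unique (right _ _ u) (base _ _ _) = contradiction u Up-irrefl
  core-unique (right _ _ u) (left _ _ v)  = contradiction v (Up-asym u)
  core-unique (right {x} {i = i} _ e u) (right _ f v) = cong (_, i) (Op.cancelˡ i x (trans (sym e) f))

  -- Levels leave only `left`, where `x ∙ y` and `x ∙ x` would coincide and cancellation would give
  -- `x ≡ y`.
  core-diagonal : ∀ {p q r} → Core p q r → ¬ Diagonal p q
  core-diagonal (base _ _ _) (diagonal _ v) = Up-irrefl v
  core-diagonal (left {x} {i = i} x≢y e u) (diagonal f v) = x≢y (Op.cancelˡ i x (trans (sym f) e))
  core-diagonal (right _ _ u) (diagonal _ v) = Up-asym u v

  diagonal-functional : ∀ {p q r} → Diagonal p q → Diagonal p r → q ≡ r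
  diagonal-functional (diagonal e u) (diagonal f v) = cong₂ _,_ (trans e (sym f)) (Up-functional u v)

  diagonal-asym : ∀ {p q} → Diagonal p q → ¬ Diagonal q p
  diagonal-asym (diagonal _ u) (diagonal _ v) = Up-asym u v

  diagonal-≢ : ∀ {p q} → Diagonal p q → p ≢ q
  diagonal-≢ (diagonal _ u) refl = Up-irrefl u

  diagonal-from : ∀ p → ∃ (Diagonal p)
  diagonal-from (x , i) = let j , u = next i in (x ∙[ i ] x , j) , diagonal refl u

  data CoreCover (p q : Point) : Set where
    core  : ∀ {r} → Core p q r → CoreCover p q
    above : Diagonal p q → CoreCover p q
    below : Diagonal q p → CoreCover p q

  -- Between consecutive levels the candidate for the third point is the left quotient; the edge is
  -- a diagonal exactly when this quotient is the lower end itself.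
  core-cover : ∀ {p q} → p ≢ q → CoreCover p q
  core-cover {x , i} {y , j} p≢q with compare i j
  ... | same refl = let k , u = next i in core (base (p≢q ∘ cong (_, i)) refl u)
  ... | up u with x ≟ (Op._\\_ i x y)
  ...   | yes e = above (diagonal (trans (sym (Op.leftDividesˡ i x y)) (cong (x ∙[ i ]_) (sym e))) u)
  ...   | no x≢ = core (left x≢ (sym (Op.leftDividesˡ i x y)) u)
  core-cover {x , i} {y , j} p≢q | down u with y ≟ (Op._\\_ j y x)
  ...   | yes e = below (diagonal (trans (sym (Op.leftDividesˡ j y x)) (cong (y ∙[ j ]_) (sym e))) u)
  ...   | no y≢ = core (right y≢ (sym (Op.leftDividesˡ j y x)) u)

-- Designs from the Bose triangles.

module OnePoint {Q : Set} (_≟_ : DecidableEquality Q) (op : CommutativeQuasigroup Q) where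

  open Bose _≟_ (λ _ → op)

  pattern ∞ = inj₁ zero

  data Tri : (x y z : Fin 1 ⊎ Point) → Set where
    core : ∀ {p q r} → Core p q r → Tri (inj₂ p) (inj₂ q) (inj₂ r)

  -- Exactly one diagonal starts at each `p`; with the edge from `p` to `∞` it forms the path with
  -- centre `p`. All points except the slack point `∞` are therefore centres.
  data Path : (v a b : Fin 1 ⊎ Point) → Set where
    ∞-first : ∀ {p q} → Diagonal p q → Path (inj₂ p) ∞ (inj₂ q)
    ∞-last  : ∀ {p q} → Diagonal p q → Path (inj₂ p) (inj₂ q) ∞

  One : (x y : Fin 1 ⊎ Point) → Set
  One _ _ = Absurd

  design : Design (Fin 1 ⊎ Point)
  design = record
    { Tri = Tri ; Path = Path ; One = One
    ; cover = cover
    ; tri-swap = λ { (core c) → core (core-swap c) }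
    ; tri-rotate = λ { (core c) → core (core-rotate c) }
    ; tri-≢ = λ { (core c) e → core-≢ c (inj₂-injective e) }
    ; path-swap = λ { (∞-first d) → ∞-last d ; (∞-last d) → ∞-first d }
    ; path-≢ = λ { (∞-first _) () ; (∞-last d) e → diagonal-≢ d (inj₂-injective e) }
    ; path-ends-≢ = λ { (∞-first _) () ; (∞-last _) () }
    ; one-sym = λ ()
    ; one-≢ = λ ()
    ; tri-unique = λ { (core c) (core c′) → cong inj₂ (core-unique c c′) }
    ; tri-path = λ { (core c) (∞-last d) → core-diagonal c d }
    ; tri-one = λ _ ()
    ; path-path = λ { (∞-last d) (∞-last d′) → diagonal-asym d d′ }
    ; centre-unique = centre-unique
    ; path-one = λ _ ()
    ; path-open = λ _ ()
    ; one-unique = λ ()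
    ; slack = ∞
    ; claimed = λ { ∞ → inj₁ refl ; (inj₂ p) → inj₂ (centre (∞-first (proj₂ (diagonal-from p)))) }
    }
    where
    cover : ∀ {x y} → x ≢ y → Cover Tri Path One x y
    cover {∞} {∞} x≢y = contradiction refl x≢y
    cover {∞} {inj₂ q} _ = into (∞-first (proj₂ (diagonal-from q)))
    cover {inj₂ p} {∞} _ = out (∞-first (proj₂ (diagonal-from p)))
    cover {inj₂ p} {inj₂ q} x≢y with core-cover (x≢y ∘ cong inj₂)
    ... | core c  = tri (core c)
    ... | above d = out (∞-last d)
    ... | below d = into (∞-last d)
    centre-unique : ∀ {v a b c d} → Path v a b → Path v c d → (a ≡ c × b ≡ d) ⊎ (a ≡ d × b ≡ c)
    centre-unique (∞-first d) (∞-first d′) = inj₁ (refl , cong inj₂ (diagonal-functional d d′))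
    centre-unique (∞-first d) (∞-last d′)  = inj₂ (refl , cong inj₂ (diagonal-functional d d′))
    centre-unique (∞-last d)  (∞-first d′) = inj₂ (cong inj₂ (diagonal-functional d d′) , refl)
    centre-unique (∞-last d)  (∞-last d′)  = inj₁ (cong inj₂ (diagonal-functional d d′) , refl)

-- If σ fixed x, the single edge from (x , 0F) to (σ x , 1F) would close the path with centre (x , 2F).
module Shifted {Q : Set} (_≟_ : DecidableEquality Q) (op : Fin 3 → CommutativeQuasigroup Q) (o : Q) (σ σ⁻¹ : Q → Q)
  (diagonal₀ : ∀ x → Bose._∙[_]_ _≟_ op x 0F x ≡ σ x)
  (diagonal₁ : ∀ x → Bose._∙[_]_ _≟_ op x 1F x ≡ x)
  (diagonal₂ : ∀ x → Bose._∙[_]_ _≟_ op x 2F x ≡ x)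
  (σσ⁻¹ : ∀ x → σ (σ⁻¹ x) ≡ x) (σ⁻¹σ : ∀ x → σ⁻¹ (σ x) ≡ x) (σ-fixed-point-free : ∀ x → σ x ≢ x) where

  open Bose _≟_ op

  -- The diagonals leaving levels 1 and 2 are vertical and form a path with centre `(x , 2F)`, while
  -- those leaving level 0 match levels 0 and 1 along `σ`.
  data Path : Point → Point → Point → Set where
    path₁₀ : ∀ {x} → Path (x , 2F) (x , 1F) (x , 0F)
    path₀₁ : ∀ {x} → Path (x , 2F) (x , 0F) (x , 1F)

  data One : Point → Point → Set where
    one₀₁ : ∀ {x z} → z ≡ σ x → One (x , 0F) (z , 1F)
    one₁₀ : ∀ {x z} → z ≡ σ x → One (z , 1F) (x , 0F)

  σ-injective : ∀ {x y} → σ x ≡ σ y → x ≡ y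
  σ-injective eq = trans (sym (σ⁻¹σ _)) (trans (cong σ⁻¹ eq) (σ⁻¹σ _))

  diagonal-from₁ : ∀ x → Diagonal (x , 1F) (x , 2F)
  diagonal-from₁ x = diagonal (sym (diagonal₁ x)) up₁

  diagonal-from₂ : ∀ x → Diagonal (x , 2F) (x , 0F)
  diagonal-from₂ x = diagonal (sym (diagonal₂ x)) up₂

  diagonal-from₀ : ∀ {x z} → z ≡ σ x → Diagonal (x , 0F) (z , 1F)
  diagonal-from₀ {x} refl = diagonal (sym (diagonal₀ x)) up₀

  design : Design Point
  design = record
    { Tri = Core ; Path = Path ; One = One
    ; cover = cover
    ; tri-swap = core-swap
    ; tri-rotate = core-rotate
    ; tri-≢ = core-≢
    ; path-swap = λ { path₁₀ → path₀₁ ; path₀₁ → path₁₀ }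
    ; path-≢ = λ { path₁₀ () ; path₀₁ () }
    ; path-ends-≢ = λ { path₁₀ () ; path₀₁ () }
    ; one-sym = λ { (one₀₁ e) → one₁₀ e ; (one₁₀ e) → one₀₁ e }
    ; one-≢ = λ { (one₀₁ _) () ; (one₁₀ _) () }
    ; tri-unique = core-unique
    ; tri-path = λ { c path₁₀ → core-diagonal (core-swap c) (diagonal-from₁ _)
                   ; c path₀₁ → core-diagonal c (diagonal-from₂ _) }
    ; tri-one = λ { c (one₀₁ e) → core-diagonal c (diagonal-from₀ e)
                  ; c (one₁₀ e) → core-diagonal (core-swap c) (diagonal-from₀ e) }
    ; path-path = λ { path₁₀ () ; path₀₁ () }
    ; centre-unique = λ { path₁₀ path₁₀ → inj₁ (refl , refl) ; path₁₀ path₀₁ → inj₂ (refl , refl)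
                        ; path₀₁ path₁₀ → inj₂ (refl , refl) ; path₀₁ path₀₁ → inj₁ (refl , refl) }
    ; path-one = λ { path₁₀ () ; path₀₁ () }
    ; path-open = λ { path₁₀ (one₁₀ e) → σ-fixed-point-free _ (sym e) ; path₀₁ (one₀₁ e) → σ-fixed-point-free _ (sym e) }
    ; one-unique = λ { (one₀₁ e) (one₀₁ f) → cong (_, 1F) (trans e (sym f))
                     ; (one₁₀ e) (one₁₀ f) → cong (_, 0F) (σ-injective (trans (sym e) f)) }
    -- An arbitrary point, since every point is claimed.
    ; slack = o , 0F
    ; claimed = λ { (x , 0F) → inj₂ (end (one₀₁ refl))
                  ; (x , 1F) → inj₂ (end (one₁₀ (sym (σσ⁻¹ x))))
                  ; (x , 2F) → inj₂ (centre path₁₀) }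
    }
    where
    cover : ∀ {x y} → x ≢ y → Cover Core Path One x y
    cover x≢y with core-cover x≢y
    ... | core c = tri c
    ... | above (diagonal {x} refl up₀) = one (one₀₁ (diagonal₀ x))
    ... | above (diagonal {x} refl up₁) rewrite diagonal₁ x = into path₁₀
    ... | above (diagonal {x} refl up₂) rewrite diagonal₂ x = out path₀₁
    ... | below (diagonal {x} refl up₀) = one (one₁₀ (diagonal₀ x))
    ... | below (diagonal {x} refl up₁) rewrite diagonal₁ x = out path₁₀
    ... | below (diagonal {x} refl up₂) rewrite diagonal₂ x = into path₀₁

module Idempotent {Q : Set} (_≟_ : DecidableEquality Q) (op : CommutativeQuasigroup Q)
  (idem : ∀ x → CommutativeQuasigroup._∙_ op x x ≡ x) where

  open Bose _≟_ (λ _ → op) public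

  core-vertical : ∀ {x i j q} → ¬ Core (x , i) (x , j) q
  core-vertical (base x≢x _ _)    = x≢x refl
  core-vertical {x} (left x≢y e u)  = core-diagonal (left x≢y e u) (diagonal (sym (idem x)) u)
  core-vertical {x} (right x≢y e u) = core-diagonal (left x≢y e u) (diagonal (sym (idem x)) u)

  diagonal-column : ∀ {x z i j} → Diagonal (x , i) (z , j) → x ≡ z × Up i j
  diagonal-column (diagonal {x} e u) = sym (trans e (idem x)) , u

  -- For an idempotent product the diagonals are the vertical edges, so taking each column as a
  -- triangle completes the Steiner triple system of Bose.
  data STri : Point → Point → Point → Set where
    core     : ∀ {p q r} → Core p q r → STri p q r
    vertical : ∀ {x i j k} → Cycle i j k → STri (x , i) (x , j) (x , k)

  stri-swap : ∀ {p q r} → STri p q r → STri q p r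
  stri-swap (core c)     = core (core-swap c)
  stri-swap (vertical c) = vertical (Cycle-swap c)

  stri-rotate : ∀ {p q r} → STri p q r → STri q r p
  stri-rotate (core c)     = core (core-rotate c)
  stri-rotate (vertical c) = vertical (Cycle-rotate c)

  stri-≢ : ∀ {p q r} → STri p q r → p ≢ q
  stri-≢ (core c)     e    = core-≢ c e
  stri-≢ (vertical c) refl = Cycle-≢ c refl

  stri-unique : ∀ {p q r s} → STri p q r → STri p q s → r ≡ s
  stri-unique (core c)     (core c′)     = core-unique c c′
  stri-unique (core c)     (vertical _)  = contradiction c core-vertical
  stri-unique (vertical _) (core c)      = contradiction c core-vertical
  stri-unique (vertical {x} c) (vertical c′) = cong (x ,_) (Cycle-unique c c′)

  stri-cover : ∀ {p q} → p ≢ q → ∃ (STri p q)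
  stri-cover p≢q with core-cover p≢q
  ... | core c  = _ , core c
  ... | above d with diagonal-column d
  ...   | refl , u = _ , vertical (proj₂ (Up⇒Cycle u))
  stri-cover p≢q | below d with diagonal-column d
  ...   | refl , u = _ , vertical (Cycle-swap (proj₂ (Up⇒Cycle u)))

  -- Deleting a point of a Steiner triple system turns the triangles through it into a perfect matching of single edges.
  module Punctured {n : ℕ} (Fin↔Point : Fin (suc (suc n)) ↔ Point) where

    open Inverse Fin↔Point using (to; from; strictlyInverseˡ; strictlyInverseʳ)

    to-injective : ∀ {x y} → to x ≡ to y → x ≡ y
    to-injective eq = trans (sym (strictlyInverseʳ _)) (trans (cong from eq) (strictlyInverseʳ _))

    Tri : Fin (suc n) → Fin (suc n) → Fin (suc n) → Set
    Tri x y z = STri (to (suc x)) (to (suc y)) (to (suc z))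

    Path : Fin (suc n) → Fin (suc n) → Fin (suc n) → Set
    Path _ _ _ = Absurd

    One : Fin (suc n) → Fin (suc n) → Set
    One x y = STri (to zero) (to (suc x)) (to (suc y))

    third : ∀ {x y} → x ≢ y → ∃ λ z → STri (to x) (to y) (to z)
    third x≢y = let r , t = stri-cover (x≢y ∘ to-injective) in
      from r , subst (STri _ _) (sym (strictlyInverseˡ r)) t

    design : Design (Fin (suc n))
    design = record
      { Tri = Tri ; Path = Path ; One = One
      ; cover = cover
      ; tri-swap = stri-swap
      ; tri-rotate = stri-rotate
      ; tri-≢ = λ t → stri-≢ t ∘ cong (to ∘ suc)
      ; path-swap = λ ()
      ; path-≢ = λ ()
      ; path-ends-≢ = λ ()
      ; one-sym = λ o → stri-swap (stri-rotate (stri-rotate o))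
      ; one-≢ = λ o → stri-≢ (stri-rotate o) ∘ cong (to ∘ suc)
      ; tri-unique = λ t u → Fin.suc-injective (to-injective (stri-unique t u))
      ; tri-path = λ _ ()
      ; tri-one = λ t o → case to-injective (stri-unique t (stri-rotate o)) of λ ()
      ; path-path = λ ()
      ; centre-unique = λ ()
      ; path-one = λ ()
      ; path-open = λ ()
      ; one-unique = λ o p → Fin.suc-injective (to-injective (stri-unique o p))
      ; slack = zero
      ; claimed = claimed
      }
      where
      cover : ∀ {x y} → x ≢ y → Cover Tri Path One x y
      cover x≢y with third (x≢y ∘ Fin.suc-injective)
      ... | zero  , t = one (stri-rotate (stri-rotate t))
      ... | suc z , t = tri {z = z} t
      claimed : ∀ x → x ≡ zero ⊎ Claimed Path One x
      claimed x with third {zero} {suc x} (λ ())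
      ... | zero  , t = contradiction refl (stri-≢ (stri-rotate (stri-rotate t)))
      ... | suc y , t = inj₂ (end {y = y} t)

  module TwoPoints (o : Q) where

    pattern ∞ a = inj₁ a

    -- The points ∞ a and (o , i) span a K₅, oriented with outdegree two; Apex lists the arcs from (o , i) to ∞ a.
    data Apex : Fin 3 → Fin 2 → Set where
      apex₀ : Apex 0F 0F
      apex₁ : Apex 1F 0F
      apex₂ : Apex 2F 1F

    data Tri : (x y z : Fin 2 ⊎ Point) → Set where
      core     : ∀ {p q r} → Core p q r → Tri (inj₂ p) (inj₂ q) (inj₂ r)
      vertical : ∀ {x i j k} → x ≢ o → Cycle i j k → Tri (inj₂ (x , i)) (inj₂ (x , j)) (inj₂ (x , k))

    -- Off the column of `o` the columns stay triangles, and each point is the centre of a `wedge`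
    -- to the two new points. The column of `o` gives up its triangle to absorb the edge between the
    -- new points: in the oriented K₅ the two arcs leaving a point form its path. The last four
    -- constructors are named after the ends.
    data Path : (v a b : Fin 2 ⊎ Point) → Set where
      wedge : ∀ {x i a b} → x ≢ o → a ≢ b → Path (inj₂ (x , i)) (∞ a) (∞ b)
      up-∞  : ∀ {i j a} → Up i j → Apex i a → Path (inj₂ (o , i)) (inj₂ (o , j)) (∞ a)
      ∞-up  : ∀ {i j a} → Up i j → Apex i a → Path (inj₂ (o , i)) (∞ a) (inj₂ (o , j))
      o₂-∞₁ : Path (∞ 0F) (inj₂ (o , 2F)) (∞ 1F)
      ∞₁-o₂ : Path (∞ 0F) (∞ 1F) (inj₂ (o , 2F))
      o₀-o₁ : Path (∞ 1F) (inj₂ (o , 0F)) (inj₂ (o , 1F))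
      o₁-o₀ : Path (∞ 1F) (inj₂ (o , 1F)) (inj₂ (o , 0F))

    One : (x y : Fin 2 ⊎ Point) → Set
    One _ _ = Absurd

    design : Design (Fin 2 ⊎ Point)
    design = record
      { Tri = Tri ; Path = Path ; One = One
      ; cover = cover
      ; tri-swap = λ { (core c) → core (core-swap c) ; (vertical x≢o c) → vertical x≢o (Cycle-swap c) }
      ; tri-rotate = λ { (core c) → core (core-rotate c) ; (vertical x≢o c) → vertical x≢o (Cycle-rotate c) }
      ; tri-≢ = λ { (core c) e → core-≢ c (inj₂-injective e) ; (vertical _ c) refl → Cycle-≢ c refl }
      ; path-swap = λ { (wedge x≢o a≢b) → wedge x≢o (a≢b ∘ sym) ; (up-∞ u a) → ∞-up u a ; (∞-up u a) → up-∞ u a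
                      ; o₂-∞₁ → ∞₁-o₂ ; ∞₁-o₂ → o₂-∞₁ ; o₀-o₁ → o₁-o₀ ; o₁-o₀ → o₀-o₁ }
      ; path-≢ = λ { (wedge _ _) () ; (up-∞ u _) refl → Up-irrefl u ; (∞-up _ _) ()
                   ; o₂-∞₁ () ; ∞₁-o₂ () ; o₀-o₁ () ; o₁-o₀ () }
      ; path-ends-≢ = λ { (wedge _ a≢b) refl → a≢b refl ; (up-∞ _ _) () ; (∞-up _ _) ()
                        ; o₂-∞₁ () ; ∞₁-o₂ () ; o₀-o₁ () ; o₁-o₀ () }
      ; one-sym = λ ()
      ; one-≢ = λ ()
      ; tri-unique = tri-unique
      ; tri-path = λ { (core c) (up-∞ _ _) → core-vertical c ; (vertical x≢o _) (up-∞ _ _) → x≢o refl }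
      ; tri-one = λ _ ()
      ; path-path = path-path
      ; centre-unique = centre-unique
      ; path-one = λ _ ()
      ; path-open = λ _ ()
      ; one-unique = λ ()
      ; slack = ∞ 0F
      ; claimed = claimed
      }
      where
      Apex-functional : ∀ {i a b} → Apex i a → Apex i b → a ≡ b
      Apex-functional apex₀ apex₀ = refl
      Apex-functional apex₁ apex₁ = refl
      Apex-functional apex₂ apex₂ = refl
      tri-unique : ∀ {x y z w} → Tri x y z → Tri x y w → z ≡ w
      tri-unique (core c) (core c′) = cong inj₂ (core-unique c c′)
      tri-unique (core c) (vertical _ _) = contradiction c core-vertical
      tri-unique (vertical _ _) (core c) = contradiction c core-vertical
      tri-unique (vertical {x} _ c) (vertical _ c′) = cong (λ k → inj₂ (x , k)) (Cycle-unique c c′)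
      path-path : ∀ {v a b c} → Path v a b → ¬ Path a v c
      path-path (wedge x≢o _) o₂-∞₁ = x≢o refl
      path-path (wedge x≢o _) o₀-o₁ = x≢o refl
      path-path (wedge x≢o _) o₁-o₀ = x≢o refl
      path-path (up-∞ u _) (up-∞ u′ _) = Up-asym u u′
      path-path (∞-up _ ()) o₂-∞₁
      path-path (∞-up _ ()) o₀-o₁
      path-path (∞-up _ ()) o₁-o₀
      path-path o₂-∞₁ (wedge x≢o _) = x≢o refl
      path-path o₂-∞₁ (∞-up _ ())
      path-path o₀-o₁ (wedge x≢o _) = x≢o refl
      path-path o₀-o₁ (∞-up _ ())
      path-path o₁-o₀ (wedge x≢o _) = x≢o refl
      path-path o₁-o₀ (∞-up _ ())
      centre-unique : ∀ {v a b c d} → Path v a b → Path v c d → (a ≡ c × b ≡ d) ⊎ (a ≡ d × b ≡ c)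
      -- Wedges with equal ends are discarded first, which leaves the two orders of `0F` and `1F`.
      centre-unique (wedge {a = 0F} {0F} _ a≢b) _ = contradiction refl a≢b
      centre-unique (wedge {a = 1F} {1F} _ a≢b) _ = contradiction refl a≢b
      centre-unique _ (wedge {a = 0F} {0F} _ a≢b) = contradiction refl a≢b
      centre-unique _ (wedge {a = 1F} {1F} _ a≢b) = contradiction refl a≢b
      centre-unique (wedge {a = 0F} {1F} _ _) (wedge {a = 0F} {1F} _ _) = inj₁ (refl , refl)
      centre-unique (wedge {a = 0F} {1F} _ _) (wedge {a = 1F} {0F} _ _) = inj₂ (refl , refl)
      centre-unique (wedge {a = 1F} {0F} _ _) (wedge {a = 0F} {1F} _ _) = inj₂ (refl , refl)
      centre-unique (wedge {a = 1F} {0F} _ _) (wedge {a = 1F} {0F} _ _) = inj₁ (refl , refl)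
      centre-unique (wedge x≢o _) (up-∞ _ _) = contradiction refl x≢o
      centre-unique (wedge x≢o _) (∞-up _ _) = contradiction refl x≢o
      centre-unique (up-∞ _ _) (wedge x≢o _) = contradiction refl x≢o
      centre-unique (∞-up _ _) (wedge x≢o _) = contradiction refl x≢o
      centre-unique (up-∞ u a) (up-∞ u′ a′) = inj₁ (cong (inj₂ ∘ (o ,_)) (Up-functional u u′) , cong inj₁ (Apex-functional a a′))
      centre-unique (up-∞ u a) (∞-up u′ a′) = inj₂ (cong (inj₂ ∘ (o ,_)) (Up-functional u u′) , cong inj₁ (Apex-functional a a′))
      centre-unique (∞-up u a) (up-∞ u′ a′) = inj₂ (cong inj₁ (Apex-functional a a′) , cong (inj₂ ∘ (o ,_)) (Up-functional u u′))
      centre-unique (∞-up u a) (∞-up u′ a′) = inj₁ (cong inj₁ (Apex-functional a a′) , cong (inj₂ ∘ (o ,_)) (Up-functional u u′))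
      centre-unique o₂-∞₁ o₂-∞₁ = inj₁ (refl , refl)
      centre-unique o₂-∞₁ ∞₁-o₂ = inj₂ (refl , refl)
      centre-unique ∞₁-o₂ o₂-∞₁ = inj₂ (refl , refl)
      centre-unique ∞₁-o₂ ∞₁-o₂ = inj₁ (refl , refl)
      centre-unique o₀-o₁ o₀-o₁ = inj₁ (refl , refl)
      centre-unique o₀-o₁ o₁-o₀ = inj₂ (refl , refl)
      centre-unique o₁-o₀ o₀-o₁ = inj₂ (refl , refl)
      centre-unique o₁-o₀ o₁-o₀ = inj₁ (refl , refl)
      apex : ∀ i → ∃ (Apex i)
      apex 0F = 0F , apex₀
      apex 1F = 0F , apex₁
      apex 2F = 1F , apex₂
      co : ∀ (a : Fin 2) → ∃ (a ≢_)
      co 0F = 1F , λ ()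
      co 1F = 0F , λ ()
      -- Decides which end of the edge is the centre: off the column of `o` it is always `(x , i)`,
      -- on it the orientation of the K₅ decides.
      point-∞ : ∀ x i a → (∃ λ b → Path (inj₂ (x , i)) (∞ a) b) ⊎ (∃ λ b → Path (∞ a) (inj₂ (x , i)) b)
      point-∞ x i a with x ≟ o
      ... | no x≢o = inj₁ (_ , wedge x≢o (proj₂ (co a)))
      point-∞ x 0F 0F | yes refl = inj₁ (_ , ∞-up up₀ apex₀)
      point-∞ x 0F 1F | yes refl = inj₂ (_ , o₀-o₁)
      point-∞ x 1F 0F | yes refl = inj₁ (_ , ∞-up up₁ apex₁)
      point-∞ x 1F 1F | yes refl = inj₂ (_ , o₁-o₀)
      point-∞ x 2F 0F | yes refl = inj₂ (_ , o₂-∞₁)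
      point-∞ x 2F 1F | yes refl = inj₁ (_ , ∞-up up₂ apex₂)
      cover : ∀ {x y} → x ≢ y → Cover Tri Path One x y
      cover {∞ 0F} {∞ 0F} x≢y = contradiction refl x≢y
      cover {∞ 0F} {∞ 1F} _ = out ∞₁-o₂
      cover {∞ 1F} {∞ 0F} _ = into ∞₁-o₂
      cover {∞ 1F} {∞ 1F} x≢y = contradiction refl x≢y
      cover {∞ a} {inj₂ (x , i)} _ with point-∞ x i a
      ... | inj₁ (_ , p) = into p
      ... | inj₂ (_ , p) = out p
      cover {inj₂ (x , i)} {∞ a} _ with point-∞ x i a
      ... | inj₁ (_ , p) = out p
      ... | inj₂ (_ , p) = into p
      cover {inj₂ (x , i)} {inj₂ (y , j)} x≢y with core-cover (x≢y ∘ cong inj₂)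
      ... | core c = tri (core c)
      ... | above d with diagonal-column d | x ≟ o
      ...   | refl , u | yes refl = out (up-∞ u (proj₂ (apex i)))
      ...   | refl , u | no x≢o   = tri (vertical x≢o (proj₂ (Up⇒Cycle u)))
      cover {inj₂ (x , i)} {inj₂ (y , j)} x≢y | below d with diagonal-column d | x ≟ o
      ...   | refl , u | yes refl = into (up-∞ u (proj₂ (apex j)))
      ...   | refl , u | no x≢o   = tri (vertical x≢o (Cycle-swap (proj₂ (Up⇒Cycle u))))
      claimed : ∀ x → x ≡ ∞ 0F ⊎ Claimed Path One x
      claimed (∞ 0F) = inj₁ refl
      claimed (∞ 1F) = inj₂ (centre o₀-o₁)
      claimed (inj₂ (x , i)) with x ≟ o
      ... | no x≢o   = inj₂ (centre (wedge {a = 0F} {1F} x≢o (λ ())))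
      ... | yes refl = inj₂ (centre (up-∞ (proj₂ (next i)) (proj₂ (apex i))))

module HalfIdempotent {Q : Set} (_≟_ : DecidableEquality (Fin 2 × Q)) (op : CommutativeQuasigroup (Fin 2 × Q))
  (half-idem : ∀ b x → CommutativeQuasigroup._∙_ op (b , x) (b , x) ≡ (0F , x)) (o : Q) where

  open Bose _≟_ (λ _ → op)

  data Tri : Point → Point → Point → Set where
    core     : ∀ {p q r} → Core p q r → Tri p q r
    vertical : ∀ {x i j k} → Cycle i j k → Tri ((0F , x) , i) ((0F , x) , j) ((0F , x) , k)

  Path : Point → Point → Point → Set
  Path _ _ _ = Absurd

  -- Squaring fixes `(0F , x)`, whose column becomes a triangle, and sends `(1F , x)` to `(0F , x)`.
  -- The remaining diagonals thus match each `((1F , x) , i)` with a point of the column of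
  -- `(0F , x)` on the next level, and this matching is perfect.
  data One : Point → Point → Set where
    rise : ∀ {x i j} → Up i j → One ((1F , x) , i) ((0F , x) , j)
    fall : ∀ {x i j} → Up i j → One ((0F , x) , j) ((1F , x) , i)

  diagonal-half : ∀ b {x i j} → Up i j → Diagonal ((b , x) , i) ((0F , x) , j)
  diagonal-half b {x} u = diagonal (sym (half-idem b x)) u

  core-vertical : ∀ {x i j q} → ¬ Core ((0F , x) , i) ((0F , x) , j) q
  core-vertical (base x≢x _ _) = x≢x refl
  core-vertical c@(left _ _ u)  = core-diagonal c (diagonal-half 0F u)
  core-vertical c@(right _ _ u) = core-diagonal (core-swap c) (diagonal-half 0F u)

  design : Design Point
  design = record
    { Tri = Tri ; Path = Path ; One = One
    ; cover = cover
    ; tri-swap = λ { (core c) → core (core-swap c) ; (vertical c) → vertical (Cycle-swap c) }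
    ; tri-rotate = λ { (core c) → core (core-rotate c) ; (vertical c) → vertical (Cycle-rotate c) }
    ; tri-≢ = λ { (core c) e → core-≢ c e ; (vertical c) refl → Cycle-≢ c refl }
    ; path-swap = λ ()
    ; path-≢ = λ ()
    ; path-ends-≢ = λ ()
    ; one-sym = λ { (rise u) → fall u ; (fall u) → rise u }
    ; one-≢ = λ { (rise _) () ; (fall _) () }
    ; tri-unique = λ { (core c) (core c′) → core-unique c c′
                     ; (core c) (vertical _) → contradiction c core-vertical
                     ; (vertical _) (core c) → contradiction c core-vertical
                     ; (vertical {x} c) (vertical c′) → cong ((0F , x) ,_) (Cycle-unique c c′) }
    ; tri-path = λ _ ()
    ; tri-one = λ { (core c) (rise u) → core-diagonal c (diagonal-half 1F u)
                  ; (core c) (fall u) → core-diagonal (core-swap c) (diagonal-half 1F u) }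
    ; path-path = λ ()
    ; centre-unique = λ ()
    ; path-one = λ ()
    ; path-open = λ ()
    ; one-unique = λ { (rise {x} u) (rise u′) → cong ((0F , x) ,_) (Up-functional u u′)
                     ; (fall {x} u) (fall u′) → cong ((1F , x) ,_) (Up-injective u u′) }
    -- A filler again: every point is the end of a single edge.
    ; slack = (0F , o) , 0F
    ; claimed = λ { ((0F , x) , j) → inj₂ (end (fall (proj₂ (previous j))))
                  ; ((1F , x) , i) → inj₂ (end (rise (proj₂ (next i)))) }
    }
    where
    cover-diagonal : ∀ b {x z i j} → z ≡ CommutativeQuasigroup._∙_ op (b , x) (b , x) → Up i j →
                     Cover Tri Path One ((b , x) , i) (z , j) × Cover Tri Path One (z , j) ((b , x) , i)
    cover-diagonal 0F {x} refl u rewrite half-idem 0F x =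
      tri (vertical (proj₂ (Up⇒Cycle u))) , tri (vertical (Cycle-swap (proj₂ (Up⇒Cycle u))))
    cover-diagonal 1F {x} refl u rewrite half-idem 1F x = one (rise u) , one (fall u)
    cover : ∀ {x y} → x ≢ y → Cover Tri Path One x y
    cover x≢y with core-cover x≢y
    ... | core c = tri (core c)
    ... | above (diagonal {b , _} e u) = proj₁ (cover-diagonal b e u)
    ... | below (diagonal {b , _} e u) = proj₂ (cover-diagonal b e u)

-- Quasigroups from arithmetic modulo q.

module Modular (q : ℕ) .{{_ : NonZero q}} where

  infix 4 _≋_
  _≋_ : ℕ → ℕ → Set
  a ≋ b = a % q ≡ b % q

  %-≋ : ∀ a → a % q ≋ a
  %-≋ a = m%n%n≡m%n a q

  +-≋ : ∀ {a b c d} → a ≋ b → c ≋ d → a + c ≋ b + d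
  +-≋ {a} {b} {c} {d} p r = trans (%-distribˡ-+ a c q) (trans (cong₂ (λ x y → (x + y) % q) p r) (sym (%-distribˡ-+ b d q)))

  *-≋ : ∀ {a b c d} → a ≋ b → c ≋ d → a * c ≋ b * d
  *-≋ {a} {b} {c} {d} p r = trans (%-distribˡ-* a c q) (trans (cong₂ (λ x y → (x * y) % q) p r) (sym (%-distribˡ-* b d q)))

  +k*q : ∀ a k → a + k * q ≋ a
  +k*q a k = [m+kn]%n≡m%n a k q

  reduce : ℕ → Fin q
  reduce a = a mod q

  toℕ-reduce : ∀ a → toℕ (reduce a) ≡ a % q
  toℕ-reduce a = Fin.toℕ-fromℕ< (m%n<n a q)

  reduce-≋ : ∀ a → toℕ (reduce a) ≋ a
  reduce-≋ a = trans (cong (_% q) (toℕ-reduce a)) (%-≋ a)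

  reduce-toℕ : ∀ {a} (x : Fin q) → a ≋ toℕ x → reduce a ≡ x
  reduce-toℕ {a} x a≋x = Fin.toℕ-injective (trans (toℕ-reduce a) (trans a≋x (m<n⇒m%n≡m (Fin.toℕ<n x))))

  +-∸ : ∀ (x : Fin q) → toℕ x + (q ∸ toℕ x) ≡ q
  +-∸ x = ℕ.m+[n∸m]≡n (ℕ.<⇒≤ (Fin.toℕ<n x))

  _⊕_ _⊝_ : Fin q → Fin q → Fin q
  x ⊕ y = reduce (toℕ x + toℕ y)
  -- The term `q ∸ toℕ x` represents the negative of `x`; truncation does no harm, as `toℕ x` is
  -- below `q`.
  z ⊝ x = reduce (toℕ z + (q ∸ toℕ x))

  ⊕-comm : ∀ x y → x ⊕ y ≡ y ⊕ x
  ⊕-comm x y = cong reduce (ℕ.+-comm (toℕ x) (toℕ y))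

  ⊕-⊝ : ∀ x z → x ⊕ (z ⊝ x) ≡ z
  ⊕-⊝ x z = reduce-toℕ z (trans (+-≋ {toℕ x} refl (reduce-≋ (toℕ z + (q ∸ toℕ x)))) (trans (cong (_% q) eq) (+k*q (toℕ z) 1)))
    where
    -- The factor `1 *` brings the multiple of `q` into the shape that `+k*q` removes.
    rearrange : ∀ a b c → a + (b + c) ≡ b + 1 * (a + c)
    rearrange = solve-∀
    eq : toℕ x + (toℕ z + (q ∸ toℕ x)) ≡ toℕ z + 1 * q
    eq = trans (rearrange (toℕ x) (toℕ z) _) (cong (λ w → toℕ z + 1 * w) (+-∸ x))

  ⊝-⊕ : ∀ x y → (x ⊕ y) ⊝ x ≡ y
  ⊝-⊕ x y = reduce-toℕ y (trans (+-≋ (reduce-≋ (toℕ x + toℕ y)) refl) (trans (cong (_% q) eq) (+k*q (toℕ y) 1)))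
    where
    rearrange : ∀ a b c → (a + b) + c ≡ b + 1 * (a + c)
    rearrange = solve-∀
    eq : (toℕ x + toℕ y) + (q ∸ toℕ x) ≡ toℕ y + 1 * q
    eq = trans (rearrange (toℕ x) (toℕ y) _) (cong (λ w → toℕ y + 1 * w) (+-∸ x))

  group : CommutativeQuasigroup (Fin q)
  group = record
    { _∙_ = _⊕_ ; _\\_ = λ x z → z ⊝ x ; comm = ⊕-comm ; leftDividesˡ = ⊕-⊝ ; leftDividesʳ = ⊝-⊕ }

  ⊕-identityʳ : ∀ {o} → toℕ o ≡ 0 → ∀ x → x ⊕ o ≡ x
  ⊕-identityʳ o≡0 x = reduce-toℕ x (cong (_% q) (trans (cong (toℕ x +_) o≡0) (ℕ.+-identityʳ (toℕ x))))

  -- Since 2 (h + 1) = q + 1, multiplication by `suc h` inverts doubling modulo `q`.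
  halving : ∀ h → q ≡ suc (2 * h) → Fin q ↔ Fin q
  halving h q≡ = mk↔ₛ′ (λ z → reduce (toℕ z * suc h)) (λ z → z ⊕ z)
    (λ z → reduce-toℕ z (trans (*-≋ {c = suc h} (reduce-≋ (toℕ z + toℕ z)) refl) (multiple z (multiply (toℕ z) h))))
    (λ z → reduce-toℕ z (trans (+-≋ (reduce-≋ (toℕ z * suc h)) (reduce-≋ (toℕ z * suc h))) (multiple z (double (toℕ z) h))))
    where
    multiply : ∀ z h → (z + z) * suc h ≡ z + z * suc (2 * h)
    multiply = solve-∀
    double : ∀ z h → z * suc h + z * suc h ≡ z + z * suc (2 * h)
    double = solve-∀
    multiple : ∀ {a} (z : Fin q) → a ≡ toℕ z + toℕ z * suc (2 * h) → a ≋ toℕ z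
    multiple z a≡ = trans (cong (_% q) (trans a≡ (cong (λ m → toℕ z + toℕ z * m) (sym q≡)))) (+k*q (toℕ z) (toℕ z))

-- Using the same `α` on both arguments preserves commutativity, while `β` relabels the products and
-- so adjusts the squares, on which the diagonals depend.
isotope : {Q R : Set} → CommutativeQuasigroup R → Q ↔ R → R ↔ Q → CommutativeQuasigroup Q
isotope op α β = record
  { _∙_ = λ x y → β.to (α.to x ∙ α.to y)
  ; _\\_ = λ x z → α.from (α.to x \\ β.from z)
  ; comm = λ x y → cong β.to (comm (α.to x) (α.to y))
  ; leftDividesˡ = λ x z → trans (cong (λ w → β.to (α.to x ∙ w)) (α.strictlyInverseˡ _))
                             (trans (cong β.to (leftDividesˡ _ _)) (β.strictlyInverseˡ z))
  ; leftDividesʳ = λ x y → trans (cong (λ w → α.from (α.to x \\ w)) (β.strictlyInverseʳ _))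
                             (trans (cong α.from (leftDividesʳ _ _)) (α.strictlyInverseʳ y))
  }
  where
  open CommutativeQuasigroup op
  module α = Inverse α
  module β = Inverse β

module Even (h : ℕ) .{{_ : NonZero h}} where

  private instance
    2h≢0 : NonZero (2 * h)
    2h≢0 = ℕ.m*n≢0 2 h

  open Modular (2 * h)

  code : (Fin 2 × Fin h) ↔ Fin (2 * h)
  code = ↔-sym (Fin.*↔× {2} {h})

  -- s ↦ (s % 2 , s / 2)
  halve : Fin (2 * h) ↔ (Fin 2 × Fin h)
  halve = ×-comm (Fin h) (Fin 2) ↔-∘ (Fin.*↔× {h} {2} ↔-∘
    mk↔ₛ′ (Fin.cast e) (Fin.cast (sym e)) (Fin.cast-involutive e (sym e)) (Fin.cast-involutive (sym e) e))
    where
    e : 2 * h ≡ h * 2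
    e = ℕ.*-comm 2 h

  quasigroup : CommutativeQuasigroup (Fin 2 × Fin h)
  quasigroup = isotope group code halve

  -- The code of `(b , x)` is h b + x, whose double is 2 x modulo 2 h whatever `b` is, and `halve`
  -- sends 2 x to `(0F , x)`.
  half-idem : ∀ b x → CommutativeQuasigroup._∙_ quasigroup (b , x) (b , x) ≡ (0F , x)
  half-idem b x = trans (cong (Inverse.to halve) doubled) (Inverse.strictlyInverseˡ halve (0F , x))
    where
    w : Fin (2 * h)
    w = Inverse.from halve (0F , x)
    toℕ-w : toℕ w ≡ 2 * toℕ x + 0
    toℕ-w = trans (Fin.toℕ-cast _ (Fin.combine x 0F)) (Fin.toℕ-combine x 0F)
    rearrange : ∀ h b x → (h * b + x) + (h * b + x) ≡ (2 * x + 0) + b * (2 * h)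
    rearrange = solve-∀
    doubled : Fin.combine b x ⊕ Fin.combine b x ≡ w
    doubled = reduce-toℕ w (trans
      (cong (_% (2 * h)) (trans (cong (λ c → c + c) (Fin.toℕ-combine b x)) (rearrange h (toℕ b) (toℕ x))))
      (trans (+k*q (2 * toℕ x + 0) (toℕ b)) (cong (_% (2 * h)) (sym toℕ-w))))

module Odd (h : ℕ) where

  q : ℕ
  q = suc (2 * h)

  open Modular q public

  halve : Fin q ↔ Fin q
  halve = halving h refl

  -- The mean (x + y) / 2 modulo the odd number `q`, hence idempotent.
  quasigroup : CommutativeQuasigroup (Fin q)
  quasigroup = isotope group (↔-id _) halve

  idem : ∀ x → CommutativeQuasigroup._∙_ quasigroup x x ≡ x
  idem = Inverse.strictlyInverseˡ halve

module Shift (h : ℕ) where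

  -- The `suc` makes `q` at least 3, so that `1F` exists and differs from `0F`; adding it then has
  -- no fixed point.
  open Odd (suc h)

  σ : Fin q ↔ Fin q
  σ = mk↔ₛ′ (1F ⊕_) (_⊝ 1F) (⊕-⊝ 1F) (⊝-⊕ 1F)

  σ-fixed-point-free : ∀ x → 1F ⊕ x ≢ x
  σ-fixed-point-free x eq with CommutativeQuasigroup.cancelˡ group x {1F} {0F}
    (trans (⊕-comm x 1F) (trans eq (sym (⊕-identityʳ {0F} refl x))))
  ... | ()

  -- Following the mean by `σ` on level 0 turns the vertical diagonals there into the shifted ones.
  op : Fin 3 → CommutativeQuasigroup (Fin q)
  op 0F = isotope quasigroup (↔-id _) σ
  op 1F = quasigroup
  op 2F = quasigroup

  design : Design (Fin (q * 3))
  design = transport Fin.*↔× (Shifted.design Fin._≟_ op 0F (1F ⊕_) (_⊝ 1F)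
    (λ x → cong (1F ⊕_) (idem x)) idem idem (⊕-⊝ 1F) (⊝-⊕ 1F) σ-fixed-point-free)

-- Designs for all n, by residue modulo 3.

onePoint : ∀ q .{{_ : NonZero q}} → Design (Fin (1 + q * 3))
onePoint q = transport ((↔-id _ ⊎-↔ Fin.*↔×) ↔-∘ Fin.+↔⊎) (OnePoint.design Fin._≟_ (Modular.group q))

twoPoints : ∀ h → Design (Fin (2 + suc (2 * h) * 3))
twoPoints h = transport ((↔-id _ ⊎-↔ Fin.*↔×) ↔-∘ Fin.+↔⊎)
  (Idempotent.TwoPoints.design Fin._≟_ (Odd.quasigroup h) (Odd.idem h) 0F)

-- The order 2 + 6 h is one less than the order 3 (2 h + 1) of the Steiner triple system.
punctured : ∀ h → Design (Fin (2 + 2 * h * 3))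
punctured h = Idempotent.Punctured.design Fin._≟_ (Odd.quasigroup h) (Odd.idem h) Fin.*↔×

halfIdempotent : ∀ h → Design (Fin (2 * suc h * 3))
halfIdempotent h = transport ((Fin.*↔× ×-↔ ↔-id _) ↔-∘ Fin.*↔×)
  (HalfIdempotent.design (≡-dec Fin._≟_ Fin._≟_) (Even.quasigroup (suc h)) (Even.half-idem (suc h)) 0F)

data Parity : ℕ → Set where
  even : ∀ h → Parity (2 * h)
  odd  : ∀ h → Parity (suc (2 * h))

parity : ∀ q → Parity q
parity zero = even 0
parity (suc q) with parity q
... | even h = odd h
... | odd h  = subst Parity (ℕ.*-suc 2 h) (even (suc h))

-- Write n = 3 q + r. For r = 1 the group modulo `q` suffices. The other residues use the mean,
-- which requires an odd modulus, or its half-idempotent variant: for r = 2 and even `q` the odd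
-- modulus is q + 1. For r = 0 and odd `q` a shift without fixed points excludes q = 1, that is n =
-- 3.
design : ∀ n → 2 ≤ n → n ≢ 3 → Design (Fin n)
design n 2≤n n≢3 with n divMod 3
... | result q 0F refl with parity q
...   | even zero    = contradiction 2≤n λ ()
...   | even (suc h) = halfIdempotent h
...   | odd zero     = contradiction refl n≢3
...   | odd (suc h)  = Shift.design h
design n 2≤n n≢3 | result zero 1F refl = contradiction 2≤n λ { (s≤s ()) }
design n 2≤n n≢3 | result (suc q) 1F refl = onePoint (suc q)
design n 2≤n n≢3 | result q 2F refl with parity q
... | even h = punctured h
... | odd h  = twoPoints h

-- The exceptional case n = 3.

Kneser-3-2-edgeless : ∀ x y → ¬ Adj (Kneser 3 2) x y
Kneser-3-2-edgeless (s , p) (t , q) adj =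
  -- Decided by running through all pairs of subsets of a three-element set.
  toWitnessFalse {a? = anySubset? λ s → anySubset? λ t → (∣ s ∣ ℕ.≟ 2) ×-dec (∣ t ∣ ℕ.≟ 2) ×-dec (s ∩ t ≟ₛ ⊥)} _ (s , t , p , q , adj)

-- Without edges completeness forbids a second colour, so the value is 1 and not the 2 that the
-- general formula would give.
achromatic-3 : AchromaticNumberIs (Kneser 3 2) 1
achromatic-3 = ((λ _ → 0F) , (λ { 0F → edge {x = 0F} {1F} (λ ()) , refl })
    , (λ x y adj → contradiction adj (Kneser-3-2-edgeless x y)) , λ { 0F 0F 0≢0 → contradiction refl 0≢0 })
  , λ { zero _ _ → z≤n
      ; (suc zero) _ _ → s≤s z≤n
      ; (suc (suc l)) _ (_ , _ , complete) →
          let x , y , adj , _ = complete 0F 1F (λ ()) in contradiction adj (Kneser-3-2-edgeless x y) }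

theorem3p1 : (∀ (n : ℕ) → 2 ≤ n → n ≢ 3 → AchromaticNumberIs (Kneser n 2) ((suc n C 2) / 3))
    × AchromaticNumberIs (Kneser 3 2) 1
theorem3p1 = (λ n 2≤n n≢3 → design⇒achromatic (design n 2≤n n≢3)) , achromatic-3
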